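{- Let $p$ be a prime and let $k,\ell,m,n$ be integers with $k>0$ and $\ell,m,n\ge 0$. Put $q=p^k$, $Q=p^{\ell}$, $R=p^m$, $S=p^n$. Let $c\in\mathbb{F}_q^*$ and define \[ f(X)=(X^q-X)^{Q+1}+c\,X^{q^2(R+S)}+c\,X^{q(R+S)}+c\,X^{R+S}\in\mathbb{F}_q[X], \] i.e. $f(X)=X^{Q+1}\circ(X^q-X)+(X^{q^2}+X^q+X)\circ cX^{R+S}$. Then $f(X)$ permutes $\mathbb{F}_{q^3}$ if and only if $\gcd\bigl(q-1,(Q+1)(R+S)\bigr)=1$. Equivalently, $f(X)$ permutes $\mathbb{F}_{q^3}$ if and only if $p=2$ and $\operatorname{ord}_2(k)\le\min\bigl(\operatorname{ord}_2(\ell),\operatorname{ord}_2(m-n)\bigr)$.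
   Context: A polynomial $g\in\mathbb{F}_{q^3}[X]$ permutes $\mathbb{F}_{q^3}$ if $\alpha\mapsto g(\alpha)$ is a bijection of $\mathbb{F}_{q^3}$. For a nonzero integer $N$, $\operatorname{ord}_2(N)$ is the largest integer $s\ge 0$ with $2^s\mid N$, and $\operatorname{ord}_2(0)=\infty$. The symbol $\circ$ denotes composition of polynomials. -}

module Defs where

open import Algebra.Apartness.Bundles using (HeytingField; HeytingCommutativeRing)
open import Algebra.Bundles using (CommutativeRing)
open import Algebra.Bundles.Raw using (RawRing)
import Algebra.Construct.NaturalChoice.Min as NaturalMin
import Algebra.Definitions.RawSemiring as RawSemiringDefs
open import Data.Empty using (⊥-elim)
open import Data.Fin.Base using (Fin)
open import Data.Integer.Base using (ℤ; +0; +[1+_]; -[1+_]; 0ℤ; ∣_∣)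
open import Data.List.Base using (List; []; _∷_; map; foldr; filter; upTo)
open import Data.List.Extrema.Nat using (max; argmax-all; xs≤max)
open import Data.List.Membership.Propositional.Properties using (∈-filter⁺; ∈-upTo⁺)
import Data.List.Relation.Unary.All as All
open import Data.List.Relation.Unary.All.Properties using (all-filter)
open import Data.Nat.Base as ℕ using (ℕ; zero; suc; s≤s; NonZero)
open import Data.Nat.Divisibility using (_∣_; _∣?_; 1∣_; ∣⇒≤)
import Data.Nat.Properties as ℕₚ
open import Data.Product.Base using (_×_; _,_)
open import Function.Base using (id)
open import Function.Bundles using (Bijection)
open import Function.Definitions using (Bijective)
open import Level using (_⊔_; 0ℓ)
open import Relation.Binary.Bundles using (Setoid; TotalOrder)
import Relation.Binary.Construct.Add.Supremum.NonStrict as AddSupremum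
open import Relation.Binary.PropositionalEquality.Core as ≡ using (_≡_; _≢_; refl)
import Relation.Binary.PropositionalEquality.Properties as ≡ₚ
open import Relation.Nullary.Construct.Add.Supremum using (_⁺; [_]; ⊤⁺)

-- A polynomial is its list of coefficients, constant term first.  Trailing
-- zeros are allowed, so polynomials are compared by _≈_ below and not by _≡_.

module Polynomial {a ℓ} (R : RawRing a ℓ) where

  private module R = RawRing R

  Poly : Set a
  Poly = List R.Carrier

  coeff : Poly → ℕ → R.Carrier
  coeff []      _       = R.0#
  coeff (a ∷ _) zero    = a
  coeff (_ ∷ g) (suc i) = coeff g i

  infix  4 _≈_
  infixl 6 _+_ _-_
  infixl 7 _*_
  infix  8 -_
  infixr 9 _∘_

  _≈_ : Poly → Poly → Set ℓ
  g ≈ h = ∀ i → coeff g i R.≈ coeff h i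

  C : R.Carrier → Poly
  C a = a ∷ []

  X : Poly
  X = R.0# ∷ R.1# ∷ []

  _+_ : Poly → Poly → Poly
  []      + h       = h
  (a ∷ g) + []      = a ∷ g
  (a ∷ g) + (b ∷ h) = (a R.+ b) ∷ (g + h)

  -_ : Poly → Poly
  -_ = map R.-_

  _-_ : Poly → Poly → Poly
  g - h = g + - h

  _*_ : Poly → Poly → Poly
  []      * h = []
  (a ∷ g) * h = map (a R.*_) h + (R.0# ∷ g * h)

  polyRawRing : RawRing a ℓ
  polyRawRing = record
    { _≈_ = _≈_
    ; _+_ = _+_
    ; _*_ = _*_
    ; -_  = -_
    ; 0#  = []
    ; 1#  = C R.1#
    }

  open RawSemiringDefs (RawRing.rawSemiring polyRawRing) public using (_^_)

  eval : Poly → R.Carrier → R.Carrier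
  eval g x = foldr (λ a r → a R.+ x R.* r) R.0# g

  _∘_ : Poly → Poly → Poly
  g ∘ h = foldr (λ a r → C a + h * r) [] g

-- For a field with finitely many elements, HeytingField is the usual notion of
-- field: _≈_ is then decidable, and x # y holds iff x - y is invertible iff
-- ¬ (x ≈ y).

module _ {a ℓ₁ ℓ₂} (K : HeytingField a ℓ₁ ℓ₂) where

  open HeytingField K using (heytingCommutativeRing)
  open HeytingCommutativeRing heytingCommutativeRing using (commutativeRing)

  fieldRawRing : RawRing a ℓ₁
  fieldRawRing = CommutativeRing.rawRing commutativeRing

  fieldSetoid : Setoid a ℓ₁
  fieldSetoid = CommutativeRing.setoid commutativeRing

  HasOrder : ℕ → Set (a ⊔ ℓ₁)
  HasOrder n = Bijection (≡ₚ.setoid (Fin n)) fieldSetoid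

  open HeytingField K using (_≈_)
  open Polynomial fieldRawRing using (Poly; eval)

  Permutes : Poly → Set (a ⊔ ℓ₁)
  Permutes g = Bijective _≈_ _≈_ (eval g)

module _ {a ℓ₁ ℓ₂} (F : HeytingField a ℓ₁ ℓ₂) (q Q R S : ℕ)
         (c : HeytingField.Carrier F) where

  open Polynomial (fieldRawRing F)

  f : Poly
  f = (X ^ q - X) ^ (Q ℕ.+ 1)
    + C c * X ^ (q ℕ.^ 2 ℕ.* (R ℕ.+ S))
    + C c * X ^ (q ℕ.* (R ℕ.+ S))
    + C c * X ^ (R ℕ.+ S)

  fComposed : Poly
  fComposed = (X ^ (Q ℕ.+ 1)) ∘ (X ^ q - X)
            + (X ^ (q ℕ.^ 2) + X ^ q + X) ∘ (C c * X ^ (R ℕ.+ S))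

ℕ∞ : Set
ℕ∞ = ℕ ⁺

open AddSupremum ℕ._≤_ public using () renaming (_≤⁺_ to _≤∞_)

ℕ∞-totalOrder : TotalOrder 0ℓ 0ℓ 0ℓ
ℕ∞-totalOrder = record
  { isTotalOrder = AddSupremum.≤⁺-isTotalOrder-≡ ℕ._≤_ ℕₚ.≤-isTotalOrder }

open NaturalMin ℕ∞-totalOrder public using () renaming (_⊓_ to min∞)

-- For n > 0 only exponents s < n need be searched, since 2 ^ s ∣ n forces
-- s < 2 ^ s ≤ n; maxPow₂-divides and maxPow₂-largest confirm the maximum.
-- The value at n = 0 is never used.

maxPow₂ : ℕ → ℕ
maxPow₂ n = max 0 (filter (λ s → 2 ℕ.^ s ∣? n) (upTo n))

ord₂ : ℤ → ℕ∞
ord₂ +0           = ⊤⁺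
ord₂ N@(+[1+ _ ]) = [ maxPow₂ ∣ N ∣ ]
ord₂ N@(-[1+ _ ]) = [ maxPow₂ ∣ N ∣ ]

private
  n<2^n : ∀ n → n ℕ.< 2 ℕ.^ n
  n<2^n zero    = s≤s ℕ.z≤n
  n<2^n (suc n) = ℕₚ.≤-trans (ℕₚ.+-mono-≤ (ℕₚ.m^n>0 2 n) (n<2^n n))
    (ℕₚ.+-monoʳ-≤ (2 ℕ.^ n) (ℕₚ.m≤m+n (2 ℕ.^ n) 0))

maxPow₂-divides : ∀ n → 2 ℕ.^ maxPow₂ n ∣ n
maxPow₂-divides n =
  argmax-all id {P = λ s → 2 ℕ.^ s ∣ n} (1∣ n) (all-filter (λ s → 2 ℕ.^ s ∣? n) (upTo n))

maxPow₂-largest : ∀ n .{{_ : NonZero n}} s → 2 ℕ.^ s ∣ n → s ℕ.≤ maxPow₂ n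
maxPow₂-largest n s 2^s∣n = All.lookup (xs≤max 0 (filter (λ t → 2 ℕ.^ t ∣? n) (upTo n)))
  (∈-filter⁺ (λ t → 2 ℕ.^ t ∣? n) (∈-upTo⁺ (ℕₚ.<-≤-trans (n<2^n s) (∣⇒≤ 2^s∣n))) 2^s∣n)

ord₂-nonZero : ∀ N → N ≢ 0ℤ → ord₂ N ≡ [ maxPow₂ ∣ N ∣ ]
ord₂-nonZero +0       N≢0 = ⊥-elim (N≢0 refl)
ord₂-nonZero +[1+ _ ] _   = refl
ord₂-nonZero -[1+ _ ] _   = refl

module Submission where

-- For p odd f is even, so f(1) = f(-1), and 2 divides the gcd.  Let p = 2, put
-- σ x = x^q and L x = σ x + x, and let Tr be the trace to the fixed field F of σ.
-- Then
--   f(x) = (L x)^(Q+1) + c Tr(x^(R+S)),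
-- where the second summand lies in F and L x lies in H = ker Tr.  Writing
-- x = h + s with h ∈ H and s = Tr x gives Tr(x^(R+S)) = Tr(h^(R+S)) + s^(R+S).
-- Hence f is injective exactly when s ↦ s^(R+S) is injective on F and
-- u ↦ u^(Q+1) is injective from H to the quotient by F, and the latter reduces to
-- injectivity of a ↦ a^(Q+1) on F.  Indeed let u, v ∈ H have the same image.  If
-- u, σ u is an F-basis of H, then v = a u + b σ u with a, b ∈ F, and comparing
-- coordinates gives (a + b)^(Q+1) = a^(Q+1), so b = 0, and then a^(Q+1) = 1, so
-- a = 1.  Otherwise u^2 + u σ u + (σ u)^2 = 0, which gives
-- u^(Q+1) = σ (1 + σ) (u^(Q+1)); the same holds for v, so u^(Q+1) = v^(Q+1).
-- A power map is injective on F exactly when its exponent is coprime to q - 1.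
-- As for ord₂, let k = 2^s k′ with k′ odd.  If j = 2^s j′ then
-- (2^k)^j′ = (2^j)^k′, so a common divisor of 2^k - 1 and 2^j + 1 divides 2;
-- if t = ord₂ j < s then 2^(2^t) + 1 is a common divisor.

open import Defs
open import Algebra.Apartness.Bundles using (HeytingField; HeytingCommutativeRing)
open import Algebra.Bundles using (CommutativeRing)
open import Algebra.Bundles.Raw using (RawRing)
import Algebra.Construct.NaturalChoice.Min as NaturalMin
open import Algebra.Morphism.Structures using (IsRingHomomorphism)
import Algebra.Properties.CommutativeMonoid.Sum as MonoidSum
import Algebra.Properties.CommutativeSemigroup as CommutativeSemigroupProperties
import Algebra.Properties.CommutativeSemiring.Exp as Exp
import Algebra.Properties.Ring as RingProperties
import Algebra.Properties.Semiring.Mult as Mult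
import Algebra.Solver.Ring as RingSolver
open import Algebra.Solver.Ring.AlmostCommutativeRing
  using (fromCommutativeRing; _-Raw-AlmostCommutative⟶_; Induced-equivalence)
open import Data.Bool.Base using (Bool; true; false; _xor_; _∧_)
import Data.Bool.Properties as Boolₚ
open import Data.Fin.Base using (Fin; zero; suc; punchIn; punchOut; inject≤)
import Data.Fin.Permutation as Perm
import Data.Fin.Properties as Finₚ
open import Data.Integer.Base as ℤ using (+_; -[1+_]; +0; +[1+_])
import Data.Integer.Properties as ℤₚ
open import Data.List.Base using ([]; _∷_; map)
open import Data.Maybe.Base using (just; nothing)
open import Data.Nat.Base as ℕ using (ℕ; zero; suc; NonZero)
open import Data.Nat.Coprimality as Coprimality using (Coprime)
open import Data.Nat.Divisibility hiding (quotient)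
open import Data.Nat.GCD using (gcd; module Bézout)
open import Data.Nat.Primality using (Prime; prime⇒irreducible; prime⇒nonZero; prime[2])
import Data.Nat.Properties as ℕₚ
open import Data.Nat.Solver using (module +-*-Solver)
open import Data.Product.Base using (_×_; _,_; proj₁; proj₂; ∃)
open import Data.Sum.Base using (_⊎_; inj₁; inj₂)
open import Data.Vec.Base using (Vec; []; _∷_)
open import Function.Base using (id; _∘_)
open import Function.Bundles using (Bijection; _⇔_; mk⇔; Equivalence)
open import Function.Definitions using (Injective; Congruent; Bijective)
open import Level using (Level; 0ℓ; _⊔_)
open import Relation.Binary.Bundles using (Setoid)
import Relation.Binary.Construct.Add.Supremum.NonStrict as Supremum
open import Relation.Binary.Definitions using (Decidable; WeaklyDecidable)
open import Relation.Binary.PropositionalEquality.Core as ≡ using (_≡_; _≢_)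
import Relation.Binary.Reasoning.Setoid as SetoidReasoning
open import Relation.Nullary.Decidable.Core using (Dec; yes; no; map′; ¬?)
open import Relation.Nullary.Negation.Core using (¬_; contradiction)

-- In the second case a nonzero u satisfies σ u = ω u with ω a primitive cube root of unity. The
-- last step there, from u^(Q+1) = v^(Q+1) to u = v, asks for injectivity of the (Q+1)-st power on
-- all of K, while the hypothesis gives it only on F. With d = u + v, z = v / d and τ x = x^Q one
-- has τ u u + τ v v = τ d d (τ z + z + 1), so a failure would solve τ z + z = 1, and taking traces
-- moves that equation into F. For the converse, the (R+S)-th power is tested on F itself, where L
-- vanishes. The (Q+1)-st power is tested on multiples a x and b x of one x in H; the values of f
-- may differ in the trace summand, and adding an element of F, found as an (R+S)-th root, repairs
-- this. Hence coprimality with R + S has to come first. Inside K, F is represented by the fixed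
-- points of σ, and the power maps enter as endomorphisms, so the computations become polynomial
-- identities over the field of two elements in values such as u, σ u, τ u and τ (σ u).

-- Cancellation, powers and the number of roots of a polynomial over a field

module FieldProperties {a ℓ₁ ℓ₂} (K : HeytingField a ℓ₁ ℓ₂) where

  open HeytingField K using (tight; #⇒invertible; invertible⇒#; #-irrefl; heytingCommutativeRing)

  ring : CommutativeRing a ℓ₁
  ring = HeytingCommutativeRing.commutativeRing heytingCommutativeRing

  open CommutativeRing ring public hiding (ring; zero)
  open RingProperties (CommutativeRing.ring ring) public
  open Exp commutativeSemiring public
  open Mult semiring public using (×1-homo-*) renaming (_×_ to _·_)
  open SetoidReasoning setoid

  CharTwo : Set ℓ₁
  CharTwo = 1# + 1# ≈ 0#

  -- If `1# ≈ 0#`, all elements coincide, so `0# - 0#` is invertible and `0#` is apart from itself.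
  1≉0 : ¬ 1# ≈ 0#
  1≉0 1≈0 = #-irrefl refl (invertible⇒# {0#} {0#} (0# , trivial , trivial))
    where
    trivial : ∀ {x} → x ≈ 1#
    trivial {x} = begin
      x       ≈⟨ *-identityʳ x ⟨
      x * 1#  ≈⟨ *-congˡ 1≈0 ⟩
      x * 0#  ≈⟨ zeroʳ x ⟩
      0#      ≈⟨ 1≈0 ⟨
      1#      ∎

  -- Apartness is tight, so it suffices to refute that `y` is apart from `0#`; an inverse of `y`
  -- would turn the hypothesis into `x ≈ 0#`. Decidability of equality does not enter at this stage.
  x*y≈0⇒y≈0 : ∀ {x y} → ¬ x ≈ 0# → x * y ≈ 0# → y ≈ 0#
  x*y≈0⇒y≈0 {x} {y} x≉0 xy≈0 = proj₁ (tight y 0#) λ y#0 →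
    let i , _ , yi≈1 = #⇒invertible y#0 in x≉0 (begin
      x                    ≈⟨ *-identityʳ x ⟨
      x * 1#               ≈⟨ *-congˡ yi≈1 ⟨
      x * ((y - 0#) * i)   ≈⟨ *-congˡ (*-congʳ (trans (+-congˡ -0#≈0#) (+-identityʳ y))) ⟩
      x * (y * i)          ≈⟨ *-assoc x y i ⟨
      x * y * i            ≈⟨ *-congʳ xy≈0 ⟩
      0# * i               ≈⟨ zeroˡ i ⟩
      0#                   ∎)

  *-cancelˡ : ∀ {x y z} → ¬ x ≈ 0# → x * y ≈ x * z → y ≈ z
  *-cancelˡ {x} {y} {z} x≉0 xy≈xz = x∙y⁻¹≈ε⇒x≈y y z (x*y≈0⇒y≈0 x≉0 (begin
    x * (y - z)    ≈⟨ x[y-z]≈xy-xz x y z ⟩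
    x * y - x * z  ≈⟨ +-congʳ xy≈xz ⟩
    x * z - x * z  ≈⟨ -‿inverseʳ (x * z) ⟩
    0#             ∎))

  1^n≈1 : ∀ n → 1# ^ n ≈ 1#
  1^n≈1 zero    = refl
  1^n≈1 (suc n) = trans (*-identityˡ _) (1^n≈1 n)

  x^n≉0 : ∀ {x} → ¬ x ≈ 0# → ∀ n → ¬ x ^ n ≈ 0#
  x^n≉0 x≉0 zero    = 1≉0
  x^n≉0 x≉0 (suc n) = x^n≉0 x≉0 n ∘ x*y≈0⇒y≈0 x≉0

  ^-zeroˡ : ∀ n .{{_ : NonZero n}} → 0# ^ n ≈ 0#
  ^-zeroˡ (suc n) = zeroˡ _

  x^[m*n]≈1 : ∀ {x} m n → x ^ m ≈ 1# → x ^ (m ℕ.* n) ≈ 1#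
  x^[m*n]≈1 {x} m n x^m≈1 = begin
    x ^ (m ℕ.* n)  ≈⟨ ^-assocʳ x m n ⟨
    (x ^ m) ^ n    ≈⟨ ^-congˡ n x^m≈1 ⟩
    1# ^ n         ≈⟨ 1^n≈1 n ⟩
    1#             ∎

  -- The length serves as a strict bound on the degree, so that counting roots is an induction on
  -- `n` with no leading coefficient to follow.
  ⟦_⟧ : ∀ {n} → Vec Carrier n → Carrier → Carrier
  ⟦ []    ⟧ x = 0#
  ⟦ a ∷ g ⟧ x = a + x * ⟦ g ⟧ x

  -- Synthetic division by `X - r`: the coefficients of the quotient are the intermediate Horner
  -- values at `r`.
  quotient : ∀ {n} → Vec Carrier (suc n) → Carrier → Vec Carrier n
  quotient (a ∷ [])        r = []
  quotient (a ∷ g@(_ ∷ _)) r = ⟦ g ⟧ r ∷ quotient g r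

  ⟦⟧-quotient : ∀ {n} (g : Vec Carrier (suc n)) r x →
                ⟦ g ⟧ x ≈ (x - r) * ⟦ quotient g r ⟧ x + ⟦ g ⟧ r
  ⟦⟧-quotient (a ∷ []) r x = begin
    a + x * 0#                       ≈⟨ +-congˡ (trans (zeroʳ x) (sym (zeroʳ r))) ⟩
    a + r * 0#                       ≈⟨ +-identityˡ _ ⟨
    0# + (a + r * 0#)                ≈⟨ +-congʳ (zeroʳ (x - r)) ⟨
    (x - r) * 0# + (a + r * 0#)      ∎
  ⟦⟧-quotient (a ∷ g@(_ ∷ _)) r x = begin
    a + x * ⟦ g ⟧ x                                ≈⟨ +-congˡ (*-congˡ (⟦⟧-quotient g r x)) ⟩
    a + x * (d * h + s)                            ≈⟨ +-congˡ (distribˡ x (d * h) s) ⟩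
    a + (x * (d * h) + x * s)                      ≈⟨ +-congˡ (+-cong swap split) ⟩
    a + (d * (x * h) + (d * s + r * s))            ≈⟨ +-congˡ (+-assoc _ _ _) ⟨
    a + (d * (x * h) + d * s + r * s)              ≈⟨ +-congˡ (+-congʳ (+-comm _ _)) ⟩
    a + (d * s + d * (x * h) + r * s)              ≈⟨ +-congˡ (+-congʳ (distribˡ d s (x * h))) ⟨
    a + (d * (s + x * h) + r * s)                  ≈⟨ +-assoc _ _ _ ⟨
    a + d * (s + x * h) + r * s                    ≈⟨ +-congʳ (+-comm _ _) ⟩
    d * (s + x * h) + a + r * s                    ≈⟨ +-assoc _ _ _ ⟩
    d * (s + x * h) + (a + r * s)                  ∎
    where
    d = x - r
    h = ⟦ quotient g r ⟧ x
    s = ⟦ g ⟧ r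
    swap : x * (d * h) ≈ d * (x * h)
    swap = trans (sym (*-assoc x d h)) (trans (*-congʳ (*-comm x d)) (*-assoc d x h))
    split : x * s ≈ d * s + r * s
    split = begin
      x * s            ≈⟨ *-congʳ (+-identityʳ x) ⟨
      (x + 0#) * s     ≈⟨ *-congʳ (+-congˡ (-‿inverseˡ r)) ⟨
      (x + (- r + r)) * s  ≈⟨ *-congʳ (+-assoc x (- r) r) ⟨
      (d + r) * s      ≈⟨ distribʳ s d r ⟩
      d * s + r * s    ∎

  -- Dividing out one root shortens the vector by one, and the other roots survive because they
  -- differ from it. After `n` roots nothing but the empty vector is left.
  roots⇒zero : ∀ {n} (g : Vec Carrier n) (r : Fin n → Carrier) → Injective _≡_ _≈_ r →
               (∀ i → ⟦ g ⟧ (r i) ≈ 0#) → ∀ x → ⟦ g ⟧ x ≈ 0#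
  roots⇒zero []          r r-inj root x = refl
  roots⇒zero g@(_ ∷ _) r r-inj root x = begin
    ⟦ g ⟧ x                                  ≈⟨ factor x ⟩
    (x - r zero) * ⟦ quotient g (r zero) ⟧ x ≈⟨ *-congˡ (roots⇒zero (quotient g (r zero)) (r ∘ suc) (Finₚ.suc-injective ∘ r-inj) root′ x) ⟩
    (x - r zero) * 0#                        ≈⟨ zeroʳ _ ⟩
    0#                                       ∎
    where
    factor : ∀ x → ⟦ g ⟧ x ≈ (x - r zero) * ⟦ quotient g (r zero) ⟧ x
    factor x = trans (⟦⟧-quotient g (r zero) x) (trans (+-congˡ (root zero)) (+-identityʳ _))
    root′ : ∀ i → ⟦ quotient g (r zero) ⟧ (r (suc i)) ≈ 0#
    root′ i = x*y≈0⇒y≈0 (λ d≈0 → contradiction (r-inj (x∙y⁻¹≈ε⇒x≈y _ _ d≈0)) λ ())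
      (trans (sym (factor (r (suc i)))) (root (suc i)))

  monomial : ∀ n → Vec Carrier (suc n)
  monomial zero    = 1# ∷ []
  monomial (suc n) = 0# ∷ monomial n

  ⟦monomial⟧ : ∀ n x → ⟦ monomial n ⟧ x ≈ x ^ n
  ⟦monomial⟧ zero    x = trans (+-congˡ (zeroʳ x)) (+-identityʳ 1#)
  ⟦monomial⟧ (suc n) x = trans (+-identityˡ _) (*-congˡ (⟦monomial⟧ n x))

  -- With so many roots `X^m - 1` would vanish identically, yet its value at `0#` is `- 1#`.
  roots-of-unity-bound : ∀ m .{{_ : NonZero m}} (r : Fin (suc m) → Carrier) → Injective _≡_ _≈_ r →
                         ¬ (∀ i → r i ^ m ≈ 1#)
  roots-of-unity-bound (suc m) r r-inj root = 1≉0 (begin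
    1#                               ≈⟨ -‿involutive 1# ⟨
    - - 1#                           ≈⟨ -‿cong (sym (+-identityʳ (- 1#))) ⟩
    - (- 1# + 0#)                    ≈⟨ -‿cong (+-congˡ (zeroˡ _)) ⟨
    - (⟦ - 1# ∷ monomial m ⟧ 0#)     ≈⟨ -‿cong (roots⇒zero (- 1# ∷ monomial m) r r-inj root′ 0#) ⟩
    - 0#                             ≈⟨ -0#≈0# ⟩
    0#                               ∎)
    where
    root′ : ∀ i → - 1# + r i * ⟦ monomial m ⟧ (r i) ≈ 0#
    root′ i = trans (+-congˡ (trans (*-congˡ (⟦monomial⟧ m (r i))) (root i))) (-‿inverseˡ 1#)

-- Finite fields: enumeration, decidable equality and Fermat's theorem

module FiniteField {a ℓ₁ ℓ₂} (K : HeytingField a ℓ₁ ℓ₂) (m : ℕ) (order : HasOrder K (suc m)) where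

  open FieldProperties K
  open SetoidReasoning setoid
  open Bijection order using (to; injective; surjective)
  private
    module Sum = MonoidSum +-commutativeMonoid
    module Product = MonoidSum *-commutativeMonoid

  index : Carrier → Fin (suc m)
  index x = proj₁ (surjective x)

  to-index : ∀ x → to (index x) ≈ x
  to-index x = proj₂ (surjective x) ≡.refl

  index-cong : ∀ {x y} → x ≈ y → index x ≡ index y
  index-cong x≈y = injective (trans (to-index _) (trans x≈y (sym (to-index _))))

  index-to : ∀ i → index (to i) ≡ i
  index-to i = injective (to-index (to i))

  index-injective : ∀ {x y} → index x ≡ index y → x ≈ y
  index-injective {x} {y} eq = trans (sym (to-index x)) (trans (reflexive (≡.cong to eq)) (to-index y))

  infix 4 _≟_
  _≟_ : Decidable _≈_
  x ≟ y = map′ index-injective index-cong (index x Finₚ.≟ index y)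

  x^n≈0⇒x≈0 : ∀ {x} n → x ^ n ≈ 0# → x ≈ 0#
  x^n≈0⇒x≈0 {x} n x^n≈0 with x ≟ 0#
  ... | yes x≈0 = x≈0
  ... | no  x≉0 = contradiction x^n≈0 (x^n≉0 x≉0 n)

  x*y≈0⇒x≈0⊎y≈0 : ∀ x y → x * y ≈ 0# → x ≈ 0# ⊎ y ≈ 0#
  x*y≈0⇒x≈0⊎y≈0 x y xy≈0 with x ≟ 0#
  ... | yes x≈0 = inj₁ x≈0
  ... | no  x≉0 = inj₂ (x*y≈0⇒y≈0 x≉0 xy≈0)

  unit : Fin m → Carrier
  unit i = to (punchIn (index 0#) i)

  unit≉0 : ∀ i → ¬ unit i ≈ 0#
  unit≉0 i u≈0 = Finₚ.punchInᵢ≢i (index 0#) i (≡.trans (≡.sym (index-to _)) (index-cong u≈0))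

  unit-injective : Injective _≡_ _≈_ unit
  unit-injective {i} {j} = Finₚ.punchIn-injective (index 0#) i j ∘ injective

  injective⇒bijective : (g : Carrier → Carrier) → Congruent _≈_ _≈_ g → Injective _≈_ _≈_ g →
                        Bijective _≈_ _≈_ g
  injective⇒bijective g g-cong g-inj = g-inj , surj
    where
    surj : ∀ y → ∃ λ x → ∀ {z} → z ≈ x → g z ≈ y
    surj y with Finₚ.any? (λ i → g (to i) ≟ y)
    ... | yes (i , gi≈y) = to i , λ z≈x → trans (g-cong z≈x) gi≈y
    ... | no  y-missed   = contradiction (Finₚ.pigeonhole (ℕₚ.n<1+n m) avoid) λ
      (i , j , i<j , eq) → Finₚ.<⇒≢ i<j
        (injective (g-inj (index-injective (Finₚ.punchOut-injective (y≢ i) (y≢ j) eq))))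
      where
      y≢ : ∀ i → index y ≢ index (g (to i))
      y≢ i eq = y-missed (i , sym (index-injective eq))
      avoid : Fin (suc m) → Fin m
      avoid i = punchOut (y≢ i)

  inverse : ∀ {x} → ¬ x ≈ 0# → ∃ λ i → x * i ≈ 1#
  inverse {x} x≉0 =
    let i , xi≈1 = proj₂ (injective⇒bijective (x *_) *-congˡ (*-cancelˡ x≉0)) 1# in i , xi≈1 refl

  -- Adding `1#` permutes the field, so the sum of all elements stays the same while it gains
  -- `suc m` copies of `1#`.
  1+m×1≈0 : suc m · 1# ≈ 0#
  1+m×1≈0 = +-cancelˡ (Sum.sum to) _ _ (begin
    Sum.sum to + suc m · 1#                  ≈⟨ +-congˡ (Sum.sum-replicate (suc m)) ⟨
    Sum.sum to + Sum.sum {suc m} (λ _ → 1#)      ≈⟨ Sum.∑-distrib-+ to (λ _ → 1#) ⟨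
    Sum.sum (λ i → to i + 1#)                    ≈⟨ Sum.sum-cong-≋ (λ i → to-index (to i + 1#)) ⟨
    Sum.sum (λ i → to (index (to i + 1#)))       ≈⟨ Sum.sum-permute to shift ⟨
    Sum.sum to                                   ≈⟨ +-identityʳ _ ⟨
    Sum.sum to + 0#                              ∎)
    where
    shift : Perm.Permutation (suc m) (suc m)
    shift = Perm.permutation (λ i → index (to i + 1#)) (λ i → index (to i - 1#))
      (λ i → ≡.trans (index-cong (trans (+-congʳ (to-index _)) (//-rightDividesˡ 1# (to i)))) (index-to i))
      (λ i → ≡.trans (index-cong (trans (+-congʳ (to-index _)) (//-rightDividesʳ 1# (to i)))) (index-to i))

  -- Fermat's argument, with the product taken over all elements so that multiplication by `x`
  -- permutes the whole index set. To keep the product nonzero, `h` puts `1#` in place of the zero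
  -- element, and `w` withholds the factor `x` there.
  x^m≈1 : ∀ {x} → ¬ x ≈ 0# → x ^ m ≈ 1#
  x^m≈1 {x} x≉0 = *-cancelˡ Πh≉0 (begin
    Π h * x ^ m                            ≈⟨ *-congˡ Πw≈x^m ⟨
    Π h * Π w                              ≈⟨ Product.∑-distrib-+ h w ⟨
    Π (λ i → h i * w i)                    ≈⟨ Product.sum-cong-≋ scaled ⟨
    Π (λ i → h (index (x * to i)))         ≈⟨ Product.sum-permute h scale ⟨
    Π h                                    ≈⟨ *-identityʳ _ ⟨
    Π h * 1#                               ∎)
    where
    Π : ∀ {k} → (Fin k → Carrier) → Carrier
    Π = Product.sum

    replaceZero : ∀ {y} → Carrier → Dec (y ≈ 0#) → Carrier
    replaceZero z (yes _) = 1#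
    replaceZero z (no _)  = z

    h w : Fin (suc m) → Carrier
    h i = replaceZero (to i) (to i ≟ 0#)
    w i = replaceZero x (to i ≟ 0#)

    x⁻¹ = proj₁ (inverse x≉0)

    scale : Perm.Permutation (suc m) (suc m)
    scale = Perm.permutation (λ i → index (x * to i)) (λ i → index (x⁻¹ * to i))
      (λ i → ≡.trans (index-cong (cancel (proj₂ (inverse x≉0)) (to i))) (index-to i))
      (λ i → ≡.trans (index-cong (cancel (trans (*-comm _ _) (proj₂ (inverse x≉0))) (to i))) (index-to i))
      where
      cancel : ∀ {a b} → a * b ≈ 1# → ∀ y → a * to (index (b * y)) ≈ y
      cancel {a} {b} ab≈1 y = begin
        a * to (index (b * y))  ≈⟨ *-congˡ (to-index _) ⟩
        a * (b * y)             ≈⟨ *-assoc a b y ⟨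
        a * b * y               ≈⟨ *-congʳ ab≈1 ⟩
        1# * y                  ≈⟨ *-identityˡ y ⟩
        y                       ∎

    scaled : ∀ i → h (index (x * to i)) ≈ h i * w i
    scaled i with to i ≟ 0# | to (index (x * to i)) ≟ 0#
    ... | yes _   | yes _    = sym (*-identityʳ 1#)
    ... | no _    | no _     = trans (to-index _) (*-comm x (to i))
    ... | yes i≈0 | no xi≉0  = contradiction (trans (to-index _) (trans (*-congˡ i≈0) (zeroʳ x))) xi≉0
    ... | no i≉0  | yes xi≈0 = contradiction (x*y≈0⇒y≈0 x≉0 (trans (sym (to-index _)) xi≈0)) i≉0

    h≉0 : ∀ i → ¬ h i ≈ 0#
    h≉0 i with to i ≟ 0#
    ... | yes _   = 1≉0
    ... | no i≉0  = i≉0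

    Π≉0 : ∀ {k} (g : Fin k → Carrier) → (∀ i → ¬ g i ≈ 0#) → ¬ Π g ≈ 0#
    Π≉0 {zero}  g g≉0 = 1≉0
    Π≉0 {suc k} g g≉0 = Π≉0 (g ∘ suc) (g≉0 ∘ suc) ∘ x*y≈0⇒y≈0 (g≉0 zero)

    Πh≉0 : ¬ Π h ≈ 0#
    Πh≉0 = Π≉0 h h≉0

    Πw≈x^m : Π w ≈ x ^ m
    Πw≈x^m = begin
      Π w                                             ≈⟨ Product.sum-remove {i = index 0#} w ⟩
      w (index 0#) * Π (w ∘ punchIn (index 0#))       ≈⟨ *-cong w0≈1 (Product.sum-cong-≋ w≈x) ⟩
      1# * Π {m} (λ _ → x)                            ≈⟨ *-identityˡ _ ⟩
      Π {m} (λ _ → x)                                 ≈⟨ Product.sum-replicate m ⟩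
      x ^ m                                           ∎
      where
      w0≈1 : w (index 0#) ≈ 1#
      w0≈1 with to (index 0#) ≟ 0#
      ... | yes _  = refl
      ... | no 0≉0 = contradiction (to-index 0#) 0≉0
      w≈x : ∀ i → w (punchIn (index 0#) i) ≈ x
      w≈x i with to (punchIn (index 0#) i) ≟ 0#
      ... | yes u≈0 = contradiction u≈0 (unit≉0 i)
      ... | no _    = refl

  x^[1+m]≈x : ∀ x → x ^ suc m ≈ x
  x^[1+m]≈x x with x ≟ 0#
  ... | yes x≈0 = trans (*-congʳ x≈0) (trans (zeroˡ _) (sym x≈0))
  ... | no  x≉0 = trans (*-congˡ (x^m≈1 x≉0)) (*-identityʳ x)

-- Arithmetic of coefficient lists and the two forms of f

module PolynomialProperties {a ℓ} (R : CommutativeRing a ℓ) where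

  private module R = CommutativeRing R
  open Polynomial R.rawRing renaming (_∘_ to _∘ᴾ_)
  open Exp R.commutativeSemiring using () renaming (_^_ to _^ᴿ_)
  open CommutativeSemigroupProperties R.+-commutativeSemigroup using (interchange)

  -- Wrapping the pointwise relation in a record lets its two sides be inferred.
  record _≋_ (g h : Poly) : Set ℓ where
    constructor coefficientwise
    field coefficients : g ≈ h

  infix 4 _≋_
  open _≋_ public

  ≋-setoid : Setoid a ℓ
  ≋-setoid = record
    { Carrier = Poly
    ; _≈_ = _≋_
    ; isEquivalence = record
      { refl  = coefficientwise λ _ → R.refl
      ; sym   = λ (coefficientwise e) → coefficientwise λ i → R.sym (e i)
      ; trans = λ (coefficientwise e) (coefficientwise e′) → coefficientwise λ i → R.trans (e i) (e′ i)
      }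
    }

  open Setoid ≋-setoid public using () renaming (refl to ≋-refl; sym to ≋-sym; trans to ≋-trans)
  open SetoidReasoning ≋-setoid

  ∷-cong : ∀ {x y g h} → x R.≈ y → g ≋ h → x ∷ g ≋ y ∷ h
  ∷-cong x≈y g≋h = coefficientwise λ { zero → x≈y ; (suc i) → coefficients g≋h i }

  tail≋ : ∀ {x y g h} → x ∷ g ≋ y ∷ h → g ≋ h
  tail≋ e = coefficientwise λ i → coefficients e (suc i)

  0∷[]≋[] : R.0# ∷ [] ≋ []
  0∷[]≋[] = coefficientwise λ { zero → R.refl ; (suc _) → R.refl }

  coeff-+ : ∀ g h i → coeff (g + h) i R.≈ coeff g i R.+ coeff h i
  coeff-+ []      h       i       = R.sym (R.+-identityˡ _)
  coeff-+ (x ∷ g) []      i       = R.sym (R.+-identityʳ _)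
  coeff-+ (x ∷ g) (y ∷ h) zero    = R.refl
  coeff-+ (x ∷ g) (y ∷ h) (suc i) = coeff-+ g h i

  coeff-map : ∀ x g i → coeff (map (x R.*_) g) i R.≈ x R.* coeff g i
  coeff-map x []      i       = R.sym (R.zeroʳ x)
  coeff-map x (y ∷ g) zero    = R.refl
  coeff-map x (y ∷ g) (suc i) = coeff-map x g i

  +-cong : ∀ {g g′ h h′} → g ≋ g′ → h ≋ h′ → g + h ≋ g′ + h′
  +-cong {g} {g′} {h} {h′} e e′ = coefficientwise λ i → R.trans (coeff-+ g h i)
    (R.trans (R.+-cong (coefficients e i) (coefficients e′ i)) (R.sym (coeff-+ g′ h′ i)))

  +-identityʳ : ∀ g → g + [] ≋ g
  +-identityʳ []      = ≋-refl
  +-identityʳ (x ∷ g) = ≋-refl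

  +-assoc : ∀ g h k → (g + h) + k ≋ g + (h + k)
  +-assoc []      h       k       = ≋-refl
  +-assoc (x ∷ g) []      k       = ≋-refl
  +-assoc (x ∷ g) (y ∷ h) []      = ≋-refl
  +-assoc (x ∷ g) (y ∷ h) (z ∷ k) = ∷-cong (R.+-assoc x y z) (+-assoc g h k)

  +-interchange : ∀ g h k l → (g + h) + (k + l) ≋ (g + k) + (h + l)
  +-interchange g h k l = coefficientwise λ i → R.trans (expand g h k l i)
    (R.trans (interchange _ _ _ _) (R.sym (expand g k h l i)))
    where
    expand : ∀ g h k l i → coeff ((g + h) + (k + l)) i R.≈
             (coeff g i R.+ coeff h i) R.+ (coeff k i R.+ coeff l i)
    expand g h k l i = R.trans (coeff-+ (g + h) (k + l) i) (R.+-cong (coeff-+ g h i) (coeff-+ k l i))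

  scale-cong : ∀ {x y g h} → x R.≈ y → g ≋ h → map (x R.*_) g ≋ map (y R.*_) h
  scale-cong {x} {y} {g} {h} x≈y e = coefficientwise λ i → R.trans (coeff-map x g i)
    (R.trans (R.*-cong x≈y (coefficients e i)) (R.sym (coeff-map y h i)))

  scale-0 : ∀ g → map (R.0# R.*_) g ≋ []
  scale-0 g = coefficientwise λ i → R.trans (coeff-map R.0# g i) (R.zeroˡ _)

  scale-1 : ∀ g → map (R.1# R.*_) g ≋ g
  scale-1 g = coefficientwise λ i → R.trans (coeff-map R.1# g i) (R.*-identityˡ _)

  scale-+ : ∀ x g h → map (x R.*_) (g + h) ≋ map (x R.*_) g + map (x R.*_) h
  scale-+ x []      h       = ≋-refl
  scale-+ x (y ∷ g) []      = ≋-refl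
  scale-+ x (y ∷ g) (z ∷ h) = ∷-cong (R.distribˡ x y z) (scale-+ x g h)

  *-congˡ : ∀ g {h h′} → h ≋ h′ → g * h ≋ g * h′
  *-congˡ []      e = ≋-refl
  *-congˡ (x ∷ g) e = +-cong (scale-cong R.refl e) (∷-cong R.refl (*-congˡ g e))

  *-zeroˡ : ∀ {g} h → g ≋ [] → g * h ≋ []
  *-zeroˡ {[]}    h e = ≋-refl
  *-zeroˡ {x ∷ g} h e = begin
    map (x R.*_) h + (R.0# ∷ g * h)  ≈⟨ +-cong (≋-trans (scale-cong (coefficients e 0) ≋-refl) (scale-0 h))
                                               (∷-cong R.refl (*-zeroˡ {g} h (coefficientwise λ i → coefficients e (suc i)))) ⟩
    R.0# ∷ []                        ≈⟨ 0∷[]≋[] ⟩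
    []                               ∎

  *-congʳ : ∀ {g g′} h → g ≋ g′ → g * h ≋ g′ * h
  *-congʳ {[]}    {g′}     h e = ≋-sym (*-zeroˡ h (≋-sym e))
  *-congʳ {x ∷ g} {[]}     h e = *-zeroˡ h e
  *-congʳ {x ∷ g} {y ∷ g′} h e =
    +-cong (scale-cong (coefficients e 0) ≋-refl) (∷-cong R.refl (*-congʳ h (tail≋ e)))

  *-zeroʳ : ∀ g → g * [] ≋ []
  *-zeroʳ []      = ≋-refl
  *-zeroʳ (x ∷ g) = ≋-trans (∷-cong R.refl (*-zeroʳ g)) 0∷[]≋[]

  *-distribˡ : ∀ g h k → g * (h + k) ≋ g * h + g * k
  *-distribˡ []      h k = ≋-refl
  *-distribˡ (x ∷ g) h k = begin
    map (x R.*_) (h + k) + (R.0# ∷ g * (h + k))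
      ≈⟨ +-cong (scale-+ x h k) (∷-cong (R.sym (R.+-identityˡ R.0#)) (*-distribˡ g h k)) ⟩
    (map (x R.*_) h + map (x R.*_) k) + ((R.0# ∷ g * h) + (R.0# ∷ g * k))
      ≈⟨ +-interchange (map (x R.*_) h) (map (x R.*_) k) (R.0# ∷ g * h) (R.0# ∷ g * k) ⟩
    (x ∷ g) * h + (x ∷ g) * k ∎

  C-* : ∀ x g → C x * g ≋ map (x R.*_) g
  C-* x g = ≋-trans (+-cong ≋-refl 0∷[]≋[]) (+-identityʳ _)

  X-* : ∀ g → X * g ≋ R.0# ∷ g
  X-* g = begin
    map (R.0# R.*_) g + (R.0# ∷ C R.1# * g)  ≈⟨ +-cong (scale-0 g) (∷-cong R.refl (≋-trans (C-* R.1# g) (scale-1 g))) ⟩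
    R.0# ∷ g                                 ∎

  ∘-zeroˡ : ∀ {g} h → g ≋ [] → g ∘ᴾ h ≋ []
  ∘-zeroˡ {[]}    h e = ≋-refl
  ∘-zeroˡ {x ∷ g} h e = begin
    C x + h * (g ∘ᴾ h)  ≈⟨ +-cong (∷-cong (coefficients e 0) ≋-refl)
                                 (*-congˡ h (∘-zeroˡ {g} h (coefficientwise λ i → coefficients e (suc i)))) ⟩
    C R.0# + h * []    ≈⟨ +-cong 0∷[]≋[] (*-zeroʳ h) ⟩
    []                 ∎

  ∘-congʳ : ∀ {g g′} h → g ≋ g′ → g ∘ᴾ h ≋ g′ ∘ᴾ h
  ∘-congʳ {[]}    {g′}     h e = ≋-sym (∘-zeroˡ h (≋-sym e))
  ∘-congʳ {x ∷ g} {[]}     h e = ∘-zeroˡ h e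
  ∘-congʳ {x ∷ g} {y ∷ g′} h e =
    +-cong (∷-cong (coefficients e 0) ≋-refl) (*-congˡ h (∘-congʳ h (tail≋ e)))

  ∘-distribʳ-+ : ∀ g g′ h → (g + g′) ∘ᴾ h ≋ g ∘ᴾ h + g′ ∘ᴾ h
  ∘-distribʳ-+ []      g′       h = ≋-refl
  ∘-distribʳ-+ (x ∷ g) []       h = ≋-sym (+-identityʳ _)
  ∘-distribʳ-+ (x ∷ g) (y ∷ g′) h = begin
    C (x R.+ y) + h * ((g + g′) ∘ᴾ h)           ≈⟨ +-cong (≋-refl {C (x R.+ y)}) (*-congˡ h (∘-distribʳ-+ g g′ h)) ⟩
    (C x + C y) + h * (g ∘ᴾ h + g′ ∘ᴾ h)         ≈⟨ +-cong (≋-refl {C x + C y}) (*-distribˡ h (g ∘ᴾ h) (g′ ∘ᴾ h)) ⟩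
    (C x + C y) + (h * (g ∘ᴾ h) + h * (g′ ∘ᴾ h)) ≈⟨ +-interchange (C x) (C y) (h * (g ∘ᴾ h)) (h * (g′ ∘ᴾ h)) ⟩
    (x ∷ g) ∘ᴾ h + (y ∷ g′) ∘ᴾ h                 ∎

  X^n∘ : ∀ n h → (X ^ n) ∘ᴾ h ≋ h ^ n
  X^n∘ zero    h = ≋-trans (+-cong (≋-refl {C R.1#}) (*-zeroʳ h)) (+-identityʳ _)
  X^n∘ (suc n) h = begin
    (X * X ^ n) ∘ᴾ h         ≈⟨ ∘-congʳ h (X-* (X ^ n)) ⟩
    (R.0# ∷ X ^ n) ∘ᴾ h      ≈⟨ +-cong 0∷[]≋[] (*-congˡ h (X^n∘ n h)) ⟩
    h * h ^ n               ∎

  X∘ : ∀ h → X ∘ᴾ h ≋ h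
  X∘ h = ≋-trans (∘-congʳ h (≋-sym (≋-trans (X-* (X ^ 0)) ≋-refl))) (≋-trans (X^n∘ 1 h) (h*1≋h h))
    where
    h*1≋h : ∀ h → h * C R.1# ≋ h
    h*1≋h []      = ≋-refl
    h*1≋h (x ∷ h) = ∷-cong (R.trans (R.+-identityʳ _) (R.*-identityʳ x)) (h*1≋h h)

  monomial : R.Carrier → ℕ → Poly
  monomial x zero    = C x
  monomial x (suc n) = R.0# ∷ monomial x n

  monomial-cong : ∀ {x y} n → x R.≈ y → monomial x n ≋ monomial y n
  monomial-cong zero    x≈y = ∷-cong x≈y ≋-refl
  monomial-cong (suc n) x≈y = ∷-cong R.refl (monomial-cong n x≈y)

  scale-monomial : ∀ x y n → map (x R.*_) (monomial y n) ≋ monomial (x R.* y) n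
  scale-monomial x y zero    = ≋-refl
  scale-monomial x y (suc n) = ∷-cong (R.zeroʳ x) (scale-monomial x y n)

  C*X^n : ∀ x n → C x * X ^ n ≋ monomial x n
  C*X^n x n = ≋-trans (C-* x (X ^ n)) (≋-trans (scale-cong R.refl (X^n n))
    (≋-trans (scale-monomial x R.1# n) (monomial-cong n (R.*-identityʳ x))))
    where
    X^n : ∀ n → X ^ n ≋ monomial R.1# n
    X^n zero    = ≋-refl
    X^n (suc n) = ≋-trans (X-* (X ^ n)) (∷-cong R.refl (X^n n))

  monomial-* : ∀ x m y n → monomial x m * monomial y n ≋ monomial (x R.* y) (m ℕ.+ n)
  monomial-* x zero    y n = ≋-trans (C-* x (monomial y n)) (scale-monomial x y n)
  monomial-* x (suc m) y n = +-cong (scale-0 (monomial y n)) (∷-cong R.refl (monomial-* x m y n))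

  ^-congˡ : ∀ n {g h} → g ≋ h → g ^ n ≋ h ^ n
  ^-congˡ zero    e = ≋-refl
  ^-congˡ (suc n) {g} {h} e = ≋-trans (*-congʳ (g ^ n) e) (*-congˡ h (^-congˡ n e))

  monomial-^ : ∀ x m n → monomial x m ^ n ≋ monomial (x ^ᴿ n) (n ℕ.* m)
  monomial-^ x m zero    = ≋-refl
  monomial-^ x m (suc n) = ≋-trans (*-congˡ (monomial x m) (monomial-^ x m n)) (monomial-* x m (x ^ᴿ n) (n ℕ.* m))

  X^n∘-C*X^m : ∀ {c} n m → c ^ᴿ n R.≈ c → (X ^ n) ∘ᴾ (C c * X ^ m) ≋ C c * X ^ (n ℕ.* m)
  X^n∘-C*X^m {c} n m c^n≈c = begin
    (X ^ n) ∘ᴾ (C c * X ^ m)           ≈⟨ X^n∘ n _ ⟩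
    (C c * X ^ m) ^ n                 ≈⟨ ^-congˡ n (C*X^n c m) ⟩
    monomial c m ^ n                  ≈⟨ monomial-^ c m n ⟩
    monomial (c ^ᴿ n) (n ℕ.* m)       ≈⟨ monomial-cong (n ℕ.* m) c^n≈c ⟩
    monomial c (n ℕ.* m)              ≈⟨ C*X^n c (n ℕ.* m) ⟨
    C c * X ^ (n ℕ.* m)               ∎

module _ {a ℓ₁ ℓ₂} (F : HeytingField a ℓ₁ ℓ₂) where

  open FieldProperties F using (Carrier; ring; sym; trans; ^-assocʳ)
    renaming (_≈_ to _≈ᶠ_; _^_ to _^ᶠ_; ^-congˡ to ^ᶠ-congˡ)
  open PolynomialProperties ring
  open Polynomial (fieldRawRing F) renaming (_∘_ to _∘ᴾ_)
  open SetoidReasoning ≋-setoid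

  -- Composing `X^(q^i)` with `c X^(R+S)` raises the coefficient to `c^(q^i)`, which is `c` again by
  -- `c^q≈c`.
  f≈fComposed : ∀ q Q R S (c : Carrier) → c ^ᶠ q ≈ᶠ c → f F q Q R S c ≈ fComposed F q Q R S c
  f≈fComposed q Q R S c c^q≈c = coefficients (begin
    A + M (q ℕ.^ 2 ℕ.* N) + M (q ℕ.* N) + M N
      ≈⟨ ≋-trans (+-cong (+-assoc A (M (q ℕ.^ 2 ℕ.* N)) (M (q ℕ.* N))) (≋-refl {M N})) (+-assoc A _ (M N)) ⟩
    A + (M (q ℕ.^ 2 ℕ.* N) + M (q ℕ.* N) + M N)
      ≈⟨ +-cong (X^n∘ (Q ℕ.+ 1) (X ^ q - X)) (+-cong (+-cong (X^n∘-C*X^m (q ℕ.^ 2) N c^q²≈c) (X^n∘-C*X^m q N c^q≈c)) (X∘ (M N))) ⟨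
    (X ^ (Q ℕ.+ 1)) ∘ᴾ (X ^ q - X) + ((X ^ (q ℕ.^ 2)) ∘ᴾ M N + (X ^ q) ∘ᴾ M N + X ∘ᴾ M N)
      ≈⟨ +-cong (≋-refl {(X ^ (Q ℕ.+ 1)) ∘ᴾ (X ^ q - X)}) (≋-trans (∘-distribʳ-+ (X ^ (q ℕ.^ 2) + X ^ q) X (M N))
           (+-cong (∘-distribʳ-+ (X ^ (q ℕ.^ 2)) (X ^ q) (M N)) (≋-refl {X ∘ᴾ M N}))) ⟨
    fComposed F q Q R S c ∎)
    where
    N = R ℕ.+ S
    A = (X ^ q - X) ^ (Q ℕ.+ 1)
    M : ℕ → Poly
    M n = C c * X ^ n
    c^q²≈c : c ^ᶠ (q ℕ.^ 2) ≈ᶠ c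
    c^q²≈c rewrite ℕₚ.*-identityʳ q = trans (sym (^-assocʳ c q q)) (trans (^ᶠ-congˡ q c^q≈c) c^q≈c)

-- Evaluating polynomials over F at points of K

module Evaluation {a b ℓ₁ ℓ₂ ℓ₃ ℓ₄} (F : HeytingField a ℓ₁ ℓ₂) (K : HeytingField b ℓ₃ ℓ₄)
  (ι : HeytingField.Carrier F → HeytingField.Carrier K)
  (ι-hom : IsRingHomomorphism (fieldRawRing F) (fieldRawRing K) ι) where

  private module F = HeytingField F
  open Polynomial (fieldRawRing F) using (Poly; C; X) renaming (_+_ to _+ᴾ_; _-_ to _-ᴾ_; -_ to -ᴾ_; _*_ to _*ᴾ_; _^_ to _^ᴾ_)
  open Polynomial (fieldRawRing K) using (eval)
  open FieldProperties K
  open CommutativeSemigroupProperties +-commutativeSemigroup using (interchange)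
  open CommutativeSemigroupProperties *-commutativeSemigroup using (x∙yz≈y∙xz)
  open IsRingHomomorphism ι-hom using (⟦⟧-cong; +-homo; *-homo; -‿homo; 0#-homo; 1#-homo)
  open SetoidReasoning setoid

  -- Mapping the coefficients and evaluating are kept as one operation, the evaluation homomorphism
  -- from F[X] to K; it is the function whose bijectivity `Permutes K (map ι g)` asserts.
  ev : Poly → Carrier → Carrier
  ev g = eval (map ι g)

  ev-+ : ∀ g h x → ev (g +ᴾ h) x ≈ ev g x + ev h x
  ev-+ []      h       x = sym (+-identityˡ _)
  ev-+ (a ∷ g) []      x = sym (+-identityʳ _)
  ev-+ (a ∷ g) (b ∷ h) x = begin
    ι (a F.+ b) + x * ev (g +ᴾ h) x            ≈⟨ +-cong (+-homo a b) (trans (*-congˡ (ev-+ g h x)) (distribˡ _ _ _)) ⟩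
    ι a + ι b + (x * ev g x + x * ev h x)      ≈⟨ interchange _ _ _ _ ⟩
    ι a + x * ev g x + (ι b + x * ev h x)      ∎

  ev-neg : ∀ g x → ev (-ᴾ g) x ≈ - ev g x
  ev-neg []      x = sym -0#≈0#
  ev-neg (a ∷ g) x = begin
    ι (F.- a) + x * ev (-ᴾ g) x  ≈⟨ +-cong (-‿homo a) (trans (*-congˡ (ev-neg g x)) (sym (-‿distribʳ-* _ _))) ⟩
    - ι a + - (x * ev g x)       ≈⟨ -‿+-comm _ _ ⟩
    - (ι a + x * ev g x)         ∎

  ev-scale : ∀ c g x → ev (map (c F.*_) g) x ≈ ι c * ev g x
  ev-scale c []      x = sym (zeroʳ _)
  ev-scale c (a ∷ g) x = begin
    ι (c F.* a) + x * ev (map (c F.*_) g) x  ≈⟨ +-cong (*-homo c a) (trans (*-congˡ (ev-scale c g x)) (x∙yz≈y∙xz _ _ _)) ⟩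
    ι c * ι a + ι c * (x * ev g x)           ≈⟨ distribˡ _ _ _ ⟨
    ι c * (ι a + x * ev g x)                 ∎

  ev-* : ∀ g h x → ev (g *ᴾ h) x ≈ ev g x * ev h x
  ev-* []      h x = sym (zeroˡ _)
  ev-* (a ∷ g) h x = begin
    ev (map (a F.*_) h +ᴾ (F.0# ∷ g *ᴾ h)) x           ≈⟨ ev-+ (map (a F.*_) h) (F.0# ∷ g *ᴾ h) x ⟩
    ev (map (a F.*_) h) x + (ι F.0# + x * ev (g *ᴾ h) x) ≈⟨ +-cong (ev-scale a h x) (trans (+-congʳ 0#-homo) (+-identityˡ _)) ⟩
    ι a * ev h x + x * ev (g *ᴾ h) x                   ≈⟨ +-congˡ (trans (*-congˡ (ev-* g h x)) (sym (*-assoc _ _ _))) ⟩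
    ι a * ev h x + x * ev g x * ev h x                 ≈⟨ distribʳ _ _ _ ⟨
    (ι a + x * ev g x) * ev h x                        ∎

  ev-C : ∀ c x → ev (C c) x ≈ ι c
  ev-C c x = trans (+-congˡ (zeroʳ x)) (+-identityʳ _)

  ev-X : ∀ x → ev X x ≈ x
  ev-X x = begin
    ι F.0# + x * ev (C F.1#) x  ≈⟨ +-cong 0#-homo (*-congˡ (trans (ev-C F.1# x) 1#-homo)) ⟩
    0# + x * 1#                 ≈⟨ trans (+-identityˡ _) (*-identityʳ x) ⟩
    x                           ∎

  ev-^ : ∀ g n x → ev (g ^ᴾ n) x ≈ ev g x ^ n
  ev-^ g zero    x = trans (ev-C F.1# x) 1#-homo
  ev-^ g (suc n) x = trans (ev-* g (g ^ᴾ n) x) (*-congˡ (ev-^ g n x))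

  ev-X^n : ∀ n x → ev (X ^ᴾ n) x ≈ x ^ n
  ev-X^n n x = trans (ev-^ X n x) (^-congˡ n (ev-X x))

  ev-f : ∀ q Q R S c x → ev (f F q Q R S c) x ≈
         (x ^ q - x) ^ (Q ℕ.+ 1)
         + ι c * x ^ (q ℕ.^ 2 ℕ.* (R ℕ.+ S)) + ι c * x ^ (q ℕ.* (R ℕ.+ S)) + ι c * x ^ (R ℕ.+ S)
  ev-f q Q R S c x = trans (ev-+ (A +ᴾ M n₂ +ᴾ M n₁) (M n₀) x) (+-cong (trans (ev-+ (A +ᴾ M n₂) (M n₁) x)
    (+-cong (trans (ev-+ A (M n₂) x) (+-cong ev-A (ev-M n₂))) (ev-M n₁))) (ev-M n₀))
    where
    M : ℕ → Poly
    M n = C c *ᴾ X ^ᴾ n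
    A = (X ^ᴾ q -ᴾ X) ^ᴾ (Q ℕ.+ 1)
    n₂ = q ℕ.^ 2 ℕ.* (R ℕ.+ S)
    n₁ = q ℕ.* (R ℕ.+ S)
    n₀ = R ℕ.+ S
    ev-A : ev A x ≈ (x ^ q - x) ^ (Q ℕ.+ 1)
    ev-A = trans (ev-^ (X ^ᴾ q -ᴾ X) (Q ℕ.+ 1) x) (^-congˡ (Q ℕ.+ 1) (trans (ev-+ (X ^ᴾ q) (-ᴾ X) x)
      (+-cong (ev-X^n q x) (trans (ev-neg X x) (-‿cong (ev-X x))))))
    ev-M : ∀ n → ev (M n) x ≈ ι c * x ^ n
    ev-M n = trans (ev-* (C c) (X ^ᴾ n) x) (*-cong (ev-C c x) (ev-X^n n x))

  ev-cong : ∀ g {x y} → x ≈ y → ev g x ≈ ev g y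
  ev-cong []      x≈y = refl
  ev-cong (a ∷ g) x≈y = +-congˡ (*-cong x≈y (ev-cong g x≈y))

-- Characteristic two: identities modulo 2 and endomorphisms

module CharacteristicTwo {k ℓ₁ ℓ₂} (K : HeytingField k ℓ₁ ℓ₂) (m : ℕ) (order : HasOrder K (suc m))
  (1+1≈0 : FieldProperties.CharTwo K) where

  open FieldProperties K
  open FiniteField K m order
  open SetoidReasoning setoid

  x+x≈0 : ∀ x → x + x ≈ 0#
  x+x≈0 x = begin
    x + x              ≈⟨ +-cong (*-identityʳ x) (*-identityʳ x) ⟨
    x * 1# + x * 1#    ≈⟨ distribˡ x 1# 1# ⟨
    x * (1# + 1#)      ≈⟨ *-congˡ 1+1≈0 ⟩
    x * 0#             ≈⟨ zeroʳ x ⟩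
    0#                 ∎

  -x≈x : ∀ x → - x ≈ x
  -x≈x x = sym (+-inverseˡ-unique x x (x+x≈0 x))

  x+y≈0⇒x≈y : ∀ {x y} → x + y ≈ 0# → x ≈ y
  x+y≈0⇒x≈y {x} {y} x+y≈0 = trans (+-inverseˡ-unique x y x+y≈0) (-x≈x y)

  x≈y⇒x+y≈0 : ∀ {x y} → x ≈ y → x + y ≈ 0#
  x≈y⇒x+y≈0 {x} {y} x≈y = trans (+-congʳ x≈y) (x+x≈0 y)

  -- Coefficients in 𝔽₂, so that the solver proves identities modulo 2.
  𝔽₂ : RawRing 0ℓ 0ℓ
  𝔽₂ = record
    { Carrier = Bool ; _≈_ = _≡_ ; _+_ = _xor_ ; _*_ = _∧_ ; -_ = id ; 0# = false ; 1# = true }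

  𝔽₂⟶K : 𝔽₂ -Raw-AlmostCommutative⟶ fromCommutativeRing ring
  𝔽₂⟶K = record
    { ⟦_⟧    = ⟦_⟧₂
    ; +-homo = λ { false y → sym (+-identityˡ _) ; true false → sym (+-identityʳ 1#) ; true true → sym 1+1≈0 }
    ; *-homo = λ { false y → sym (zeroˡ _) ; true y → sym (*-identityˡ _) }
    ; -‿homo = λ x → sym (-x≈x ⟦ x ⟧₂)
    ; 0-homo = refl
    ; 1-homo = refl
    }
    where
    ⟦_⟧₂ : Bool → Carrier
    ⟦ false ⟧₂ = 0#
    ⟦ true  ⟧₂ = 1#

  𝔽₂-weaklyDecidable : WeaklyDecidable (Induced-equivalence 𝔽₂⟶K)
  𝔽₂-weaklyDecidable x y with x Boolₚ.≟ y
  ... | yes ≡.refl = just refl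
  ... | no _       = nothing

  module Solver = RingSolver 𝔽₂ (fromCommutativeRing ring) 𝔽₂⟶K 𝔽₂-weaklyDecidable
  open Solver using (solve; _:=_; _:+_; _:*_; con)

  -- The solver proves identities but takes no hypotheses. An expression known to vanish is
  -- therefore written into the identity with an explicit cofactor, and the product is struck out
  -- here.
  vanish : ∀ x y {z} → z ≈ 0# → x + y * z ≈ x
  vanish x y z≈0 = trans (+-congˡ (trans (*-congˡ z≈0) (zeroʳ y))) (+-identityʳ x)

  -- An abstract power of Frobenius. With the exponent hidden, values of `φ` enter the solver as
  -- plain variables.
  record IsEndomorphism (φ : Carrier → Carrier) : Set (k ⊔ ℓ₁) where
    field
      cong   : ∀ {x y} → x ≈ y → φ x ≈ φ y
      +-homo : ∀ x y → φ (x + y) ≈ φ x + φ y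
      *-homo : ∀ x y → φ (x * y) ≈ φ x * φ y
      1-homo : φ 1# ≈ 1#

    0-homo : φ 0# ≈ 0#
    0-homo = begin
      φ 0#           ≈⟨ cong (x+x≈0 0#) ⟨
      φ (0# + 0#)    ≈⟨ +-homo 0# 0# ⟩
      φ 0# + φ 0#    ≈⟨ x+x≈0 (φ 0#) ⟩
      0#             ∎

    nonzero : ∀ {x} → ¬ x ≈ 0# → ¬ φ x ≈ 0#
    nonzero {x} x≉0 φx≈0 = let i , xi≈1 = inverse x≉0 in 1≉0 (begin
      1#          ≈⟨ 1-homo ⟨
      φ 1#        ≈⟨ cong xi≈1 ⟨
      φ (x * i)   ≈⟨ *-homo x i ⟩
      φ x * φ i   ≈⟨ *-congʳ φx≈0 ⟩
      0# * φ i    ≈⟨ zeroˡ (φ i) ⟩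
      0#          ∎)

    fixed-inverse : ∀ {x i} → φ x ≈ x → x * i ≈ 1# → φ i ≈ i
    fixed-inverse {x} {i} φx≈x xi≈1 = *-cancelˡ x≉0 (begin
      x * φ i     ≈⟨ *-congʳ φx≈x ⟨
      φ x * φ i   ≈⟨ *-homo x i ⟨
      φ (x * i)   ≈⟨ cong xi≈1 ⟩
      φ 1#        ≈⟨ 1-homo ⟩
      1#          ≈⟨ xi≈1 ⟨
      x * i       ∎)
      where
      x≉0 : ¬ x ≈ 0#
      x≉0 x≈0 = 1≉0 (trans (sym xi≈1) (trans (*-congʳ x≈0) (zeroˡ i)))

    fixed-+ : ∀ {x y} → φ x ≈ x → φ y ≈ y → φ (x + y) ≈ x + y
    fixed-+ {x} {y} φx≈x φy≈y = trans (+-homo x y) (+-cong φx≈x φy≈y)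

    fixed-* : ∀ {x y} → φ x ≈ x → φ y ≈ y → φ (x * y) ≈ x * y
    fixed-* {x} {y} φx≈x φy≈y = trans (*-homo x y) (*-cong φx≈x φy≈y)

  x^2^i-isEndomorphism : ∀ i → IsEndomorphism (_^ (2 ℕ.^ i))
  x^2^i-isEndomorphism i = record
    { cong   = ^-congˡ (2 ℕ.^ i)
    ; +-homo = additive i
    ; *-homo = λ x y → ^-distrib-* x y (2 ℕ.^ i)
    ; 1-homo = 1^n≈1 (2 ℕ.^ i)
    }
    where
    additive : ∀ i x y → (x + y) ^ (2 ℕ.^ i) ≈ x ^ (2 ℕ.^ i) + y ^ (2 ℕ.^ i)
    additive zero    x y = trans (*-identityʳ _) (sym (+-cong (*-identityʳ x) (*-identityʳ y)))
    additive (suc i) x y = begin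
      (x + y) ^ (2 ℕ.* 2 ℕ.^ i)                        ≈⟨ ^-assocʳ (x + y) 2 (2 ℕ.^ i) ⟨
      ((x + y) ^ 2) ^ (2 ℕ.^ i)                        ≈⟨ ^-congˡ (2 ℕ.^ i) square ⟩
      (x ^ 2 + y ^ 2) ^ (2 ℕ.^ i)                      ≈⟨ additive i (x ^ 2) (y ^ 2) ⟩
      (x ^ 2) ^ (2 ℕ.^ i) + (y ^ 2) ^ (2 ℕ.^ i)        ≈⟨ +-cong (^-assocʳ x 2 (2 ℕ.^ i)) (^-assocʳ y 2 (2 ℕ.^ i)) ⟩
      x ^ (2 ℕ.* 2 ℕ.^ i) + y ^ (2 ℕ.* 2 ℕ.^ i)        ∎
      where
      square : (x + y) ^ 2 ≈ x ^ 2 + y ^ 2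
      square = solve 2 (λ x y → (x :+ y) :* ((x :+ y) :* con true) := x :* (x :* con true) :+ y :* (y :* con true)) refl x y

  -- The (Q+1)-st power on trace-zero elements, modulo fixed elements

  module Core {σ τ : Carrier → Carrier} (σ-hom : IsEndomorphism σ) (τ-hom : IsEndomorphism τ)
    (σ³≈id : ∀ x → σ (σ (σ x)) ≈ x) (στ≈τσ : ∀ x → σ (τ x) ≈ τ (σ x))
    (τa*a-injective : ∀ {a b} → σ a ≈ a → σ b ≈ b → τ a * a ≈ τ b * b → a ≈ b) where

    private
      module σ = IsEndomorphism σ-hom
      module τ = IsEndomorphism τ-hom

    -- The trace t of such a z would satisfy τ t = t + 1, so that a = t and
    -- a = t + 1 give the same τ a * a.
    τz+z≉1 : ∀ z → ¬ τ z + z ≈ 1#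
    τz+z≉1 z τz+z≈1 = 1≉0 (begin
      1#            ≈⟨ solve 1 (λ t → con true := t :+ con true :+ t) refl t ⟩
      t + 1# + t    ≈⟨ x≈y⇒x+y≈0 (τa*a-injective (σ.fixed-+ t-fixed σ.1-homo) t-fixed same) ⟩
      0#            ∎)
      where
      t = z + σ z + σ (σ z)
      t-fixed : σ t ≈ t
      t-fixed = begin
        σ (z + σ z + σ (σ z))             ≈⟨ trans (σ.+-homo _ _) (+-congʳ (σ.+-homo _ _)) ⟩
        σ z + σ (σ z) + σ (σ (σ z))       ≈⟨ +-congˡ (σ³≈id z) ⟩
        σ z + σ (σ z) + z                 ≈⟨ solve 3 (λ x y z → y :+ z :+ x := x :+ y :+ z) refl z (σ z) (σ (σ z)) ⟩
        t                                 ∎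
      conjugate : ∀ {z} → τ z + z ≈ 1# → τ (σ z) + σ z ≈ 1#
      conjugate {z} e = begin
        τ (σ z) + σ z   ≈⟨ +-congʳ (στ≈τσ z) ⟨
        σ (τ z) + σ z   ≈⟨ σ.+-homo (τ z) z ⟨
        σ (τ z + z)     ≈⟨ σ.cong e ⟩
        σ 1#            ≈⟨ σ.1-homo ⟩
        1#              ∎
      τt≈t+1 : τ t ≈ t + 1#
      τt≈t+1 = begin
        τ t
          ≈⟨ trans (τ.+-homo _ _) (+-congʳ (τ.+-homo _ _)) ⟩
        τ z + τ (σ z) + τ (σ (σ z))
          ≈⟨ solve 6 (λ x y z x′ y′ z′ → x′ :+ y′ :+ z′ := x :+ y :+ z :+ ((x′ :+ x) :+ (y′ :+ y) :+ (z′ :+ z)))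
               refl z (σ z) (σ (σ z)) (τ z) (τ (σ z)) (τ (σ (σ z))) ⟩
        t + ((τ z + z) + (τ (σ z) + σ z) + (τ (σ (σ z)) + σ (σ z)))
          ≈⟨ +-congˡ (+-cong (+-cong τz+z≈1 (conjugate τz+z≈1)) (conjugate (conjugate τz+z≈1))) ⟩
        t + (1# + 1# + 1#)
          ≈⟨ solve 1 (λ t → t :+ (con true :+ con true :+ con true) := t :+ con true) refl t ⟩
        t + 1# ∎
      same : τ (t + 1#) * (t + 1#) ≈ τ t * t
      same = begin
        τ (t + 1#) * (t + 1#)       ≈⟨ *-congʳ (trans (τ.+-homo t 1#) (+-cong τt≈t+1 τ.1-homo)) ⟩
        (t + 1# + 1#) * (t + 1#)    ≈⟨ solve 1 (λ t → (t :+ con true :+ con true) :* (t :+ con true) := (t :+ con true) :* t) refl t ⟩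
        (t + 1#) * t                ≈⟨ *-congʳ τt≈t+1 ⟨
        τ t * t                     ∎

    -- If u ≠ v then z = v / (u + v) would satisfy τ z + z = 1.
    τu*u-injective : ∀ {u v} → τ u * u ≈ τ v * v → u ≈ v
    τu*u-injective {u} {v} Uu≈Vv with u + v ≟ 0#
    ... | yes u+v≈0 = x+y≈0⇒x≈y u+v≈0
    ... | no  u+v≉0 = contradiction τz+z≈1 (τz+z≉1 (v * i))
      where
      i = proj₁ (inverse u+v≉0)
      si≈1 = proj₂ (inverse u+v≉0)
      SI≈1 : (τ u + τ v) * τ i ≈ 1#
      SI≈1 = trans (*-congʳ (sym (τ.+-homo u v))) (trans (sym (τ.*-homo (u + v) i)) (trans (τ.cong si≈1) τ.1-homo))
      τz+z≈1 : τ (v * i) + v * i ≈ 1#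
      τz+z≈1 = begin
        τ (v * i) + v * i
          ≈⟨ +-congʳ (τ.*-homo v i) ⟩
        τ v * τ i + v * i
          -- The brackets are the relations `si≈1`, `SI≈1` and `Uu≈Vv` moved to one side. Modulo the
          -- first two, the identity reads `V I + v i = 1 + i I (U u + V v)`.
          ≈⟨ solve 6 (λ u v i U V I → V :* I :+ v :* i := con true :+ U :* I :* ((u :+ v) :* i :+ con true)
               :+ (v :* i :+ con true) :* ((U :+ V) :* I :+ con true) :+ i :* I :* (U :* u :+ V :* v))
               refl u v i (τ u) (τ v) (τ i) ⟩
        1# + τ u * τ i * ((u + v) * i + 1#) + (v * i + 1#) * ((τ u + τ v) * τ i + 1#) + i * τ i * (τ u * u + τ v * v)
          ≈⟨ vanish _ _ (x≈y⇒x+y≈0 Uu≈Vv) ⟩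
        1# + τ u * τ i * ((u + v) * i + 1#) + (v * i + 1#) * ((τ u + τ v) * τ i + 1#)
          ≈⟨ vanish _ _ (x≈y⇒x+y≈0 SI≈1) ⟩
        1# + τ u * τ i * ((u + v) * i + 1#)
          ≈⟨ vanish _ _ (x≈y⇒x+y≈0 si≈1) ⟩
        1# ∎

    TraceZero : Carrier → Set ℓ₁
    TraceZero u = σ (σ u) ≈ u + σ u

    -- On the plane of trace zero σ acts as a primitive cube root of unity, and
    -- n u (σ u) is the norm form.  The class of τ u * u modulo fixed elements is
    -- determined by e₁ u = (1 + σ)(τ u * u), and e₂ u is σ (e₁ u).
    n : Carrier → Carrier → Carrier
    n u u′ = u * u + u * u′ + u′ * u′

    e₁ e₂ : Carrier → Carrier
    e₁ u = τ u * u + τ (σ u) * σ u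
    e₂ u = τ u * u + τ u * σ u + τ (σ u) * u

    e₂≈σe₁ : ∀ {u} → TraceZero u → σ (e₁ u) ≈ e₂ u
    e₂≈σe₁ {u} tr = begin
      σ (τ u * u + τ (σ u) * σ u)
        ≈⟨ trans (σ.+-homo _ _) (+-cong (σ.*-homo _ _) (σ.*-homo _ _)) ⟩
      σ (τ u) * σ u + σ (τ (σ u)) * σ (σ u)
        ≈⟨ +-cong (*-congʳ (στ≈τσ u)) (*-cong (trans (στ≈τσ (σ u)) (trans (τ.cong tr) (τ.+-homo u (σ u)))) tr) ⟩
      τ (σ u) * σ u + (τ u + τ (σ u)) * (u + σ u)
        ≈⟨ solve 4 (λ u u′ U U′ → U′ :* u′ :+ (U :+ U′) :* (u :+ u′) := U :* u :+ U :* u′ :+ U′ :* u) refl u (σ u) (τ u) (τ (σ u)) ⟩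
      e₂ u ∎

    -- Since `n x y` is `(x + ω y)(x + ω² y)` for a formal primitive cube root of unity ω, and
    -- `e₁ u + ω e₂ u` factors as `(ω τ u + τ (σ u)) (ω u + σ u)`, this is multiplicativity of the
    -- norm for adjoining ω.
    n-e : ∀ u → n (e₁ u) (e₂ u) ≈ n u (σ u) * τ (n u (σ u))
    n-e u = begin
      n (e₁ u) (e₂ u)
        ≈⟨ solve 4 (λ u u′ U U′ →
             let e₁ = U :* u :+ U′ :* u′ ; e₂ = U :* u :+ U :* u′ :+ U′ :* u in
             e₁ :* e₁ :+ e₁ :* e₂ :+ e₂ :* e₂ :=
             (u :* u :+ u :* u′ :+ u′ :* u′) :* (U :* U :+ U :* U′ :+ U′ :* U′)) refl u (σ u) (τ u) (τ (σ u)) ⟩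
      n u (σ u) * n (τ u) (τ (σ u))
        ≈⟨ *-congˡ (trans (τ.+-homo _ _) (+-cong (trans (τ.+-homo _ _) (+-cong (τ.*-homo _ _) (τ.*-homo _ _))) (τ.*-homo _ _))) ⟨
      n u (σ u) * τ (n u (σ u)) ∎

    -- For nonzero `u`, `σ u = ω u` with ω a primitive cube root of unity, so `D` is
    -- `(ω + τ ω) τ u u`. This is zero if τ fixes ω and `τ u * u` if τ maps ω to ω²; the product
    -- `D * (D + τ u * u)` covers both. In the second case `u + σ u` and `σ u` have the same image
    -- under `x ↦ τ x * x`, which forces `u` to be zero.
    τu*u≈e₂ : ∀ {u} → n u (σ u) ≈ 0# → τ u * u ≈ e₂ u
    τu*u≈e₂ {u} n≈0 = begin
      τ u * u                          ≈⟨ +-identityʳ _ ⟨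
      τ u * u + 0#                     ≈⟨ +-congˡ D≈0 ⟨
      τ u * u + D                      ≈⟨ +-assoc _ _ _ ⟨
      e₂ u                             ∎
      where
      D = τ u * σ u + τ (σ u) * u
      N≈0 : n (τ u) (τ (σ u)) ≈ 0#
      N≈0 = begin
        n (τ u) (τ (σ u))  ≈⟨ trans (τ.+-homo _ _) (+-cong (trans (τ.+-homo _ _) (+-cong (τ.*-homo _ _) (τ.*-homo _ _))) (τ.*-homo _ _)) ⟨
        τ (n u (σ u))      ≈⟨ τ.cong n≈0 ⟩
        τ 0#               ≈⟨ τ.0-homo ⟩
        0#                 ∎
      D*[D+Uu]≈0 : D * (D + τ u * u) ≈ 0#
      D*[D+Uu]≈0 = begin
        D * (D + τ u * u)
          ≈⟨ solve 4 (λ u u′ U U′ → let D = U :* u′ :+ U′ :* u in D :* (D :+ U :* u) :=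
               con false :+ u :* u :* (U :* U :+ U :* U′ :+ U′ :* U′) :+ U :* U :* (u :* u :+ u :* u′ :+ u′ :* u′))
               refl u (σ u) (τ u) (τ (σ u)) ⟩
        0# + u * u * n (τ u) (τ (σ u)) + τ u * τ u * n u (σ u)
          ≈⟨ trans (vanish _ _ n≈0) (vanish _ _ N≈0) ⟩
        0# ∎
      D≈0 : D ≈ 0#
      D≈0 with x*y≈0⇒x≈0⊎y≈0 _ _ D*[D+Uu]≈0
      ... | inj₁ D≈0    = D≈0
      ... | inj₂ D+Uu≈0 = begin
        τ u * σ u + τ (σ u) * u  ≈⟨ +-cong (*-congˡ (trans (σ.cong u≈0) σ.0-homo)) (*-congˡ u≈0) ⟩
        τ u * 0# + τ (σ u) * 0#  ≈⟨ solve 2 (λ x y → x :* con false :+ y :* con false := con false) refl (τ u) (τ (σ u)) ⟩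
        0#                       ∎
        where
        same : τ (u + σ u) * (u + σ u) ≈ τ (σ u) * σ u
        same = begin
          τ (u + σ u) * (u + σ u)
            ≈⟨ *-congʳ (τ.+-homo u (σ u)) ⟩
          (τ u + τ (σ u)) * (u + σ u)
            ≈⟨ solve 4 (λ u u′ U U′ → (U :+ U′) :* (u :+ u′) := U′ :* u′ :+ con true :* (U :* u′ :+ U′ :* u :+ U :* u))
                 refl u (σ u) (τ u) (τ (σ u)) ⟩
          τ (σ u) * σ u + 1# * (D + τ u * u)
            ≈⟨ vanish _ _ D+Uu≈0 ⟩
          τ (σ u) * σ u ∎
        u≈0 : u ≈ 0#
        u≈0 = begin
          u                  ≈⟨ solve 2 (λ u u′ → u := u :+ u′ :+ u′) refl u (σ u) ⟩
          u + σ u + σ u      ≈⟨ x≈y⇒x+y≈0 (τu*u-injective same) ⟩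
          0#                 ∎

    -- By `n-e` the vanishing of the norm form can be read off from `e₁` and `e₂`, so it passes from
    -- `u` to `v`. Then `e₂` recovers `τ u * u` and `τ v * v` exactly, not just modulo fixed
    -- elements.
    isotropic : ∀ {u v} → n u (σ u) ≈ 0# → e₁ u ≈ e₁ v → e₂ u ≈ e₂ v → u ≈ v
    isotropic {u} {v} nu≈0 e₁≈ e₂≈ = τu*u-injective (trans (τu*u≈e₂ nu≈0) (trans e₂≈ (sym (τu*u≈e₂ nv≈0))))
      where
      nv≈0 : n v (σ v) ≈ 0#
      nv≈0 with n v (σ v) ≟ 0#
      ... | yes nv≈0 = nv≈0
      ... | no  nv≉0 = contradiction (x*y≈0⇒y≈0 nv≉0 (begin
        n v (σ v) * τ (n v (σ v))  ≈⟨ n-e v ⟨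
        n (e₁ v) (e₂ v)            ≈⟨ +-cong (+-cong (*-cong e₁≈ e₁≈) (*-cong e₁≈ e₂≈)) (*-cong e₂≈ e₂≈) ⟨
        n (e₁ u) (e₂ u)            ≈⟨ n-e u ⟩
        n u (σ u) * τ (n u (σ u))  ≈⟨ *-congʳ nu≈0 ⟩
        0# * τ (n u (σ u))         ≈⟨ zeroˡ _ ⟩
        0#                         ∎)) (τ.nonzero nv≉0)

    anisotropic : ∀ {u v} → TraceZero u → TraceZero v → ¬ n u (σ u) ≈ 0# →
                  e₁ u ≈ e₁ v → e₂ u ≈ e₂ v → u ≈ v
    anisotropic {u} {v} tru trv nu≉0 e₁≈ e₂≈ = begin
      u                 ≈⟨ solve 2 (λ u u′ → u := con true :* u :+ con false :* u′) refl u (σ u) ⟩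
      1# * u + 0# * σ u ≈⟨ +-cong (*-congʳ a≈1) (*-congʳ b≈0) ⟨
      a * u + b * σ u   ≈⟨ v≈ ⟨
      v                 ∎
      where
      i = proj₁ (inverse nu≉0)
      ni≈1 = proj₂ (inverse nu≉0)
      -- Cramer's rule for v = a u + b (σ u) and its image under σ, the
      -- determinant being n u (σ u).
      a′ = (u + σ u) * v + σ u * σ v
      b′ = σ u * v + u * σ v
      a = a′ * i
      b = b′ * i
      A = τ a
      B = τ b
      n-fixed : σ (n u (σ u)) ≈ n u (σ u)
      n-fixed = begin
        σ (n u (σ u))
          ≈⟨ trans (σ.+-homo _ _) (+-cong (trans (σ.+-homo _ _) (+-cong (σ.*-homo _ _) (σ.*-homo _ _))) (σ.*-homo _ _)) ⟩
        n (σ u) (σ (σ u))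
          ≈⟨ +-cong (+-congˡ (*-congˡ tru)) (*-cong tru tru) ⟩
        n (σ u) (u + σ u)
          ≈⟨ solve 2 (λ u u′ → u′ :* u′ :+ u′ :* (u :+ u′) :+ (u :+ u′) :* (u :+ u′) := u :* u :+ u :* u′ :+ u′ :* u′) refl u (σ u) ⟩
        n u (σ u) ∎
      i-fixed = σ.fixed-inverse n-fixed ni≈1
      a-fixed : σ a ≈ a
      a-fixed = σ.fixed-* (begin
        σ a′
          ≈⟨ trans (σ.+-homo _ _) (+-cong (trans (σ.*-homo _ _) (*-congʳ (σ.+-homo _ _))) (σ.*-homo _ _)) ⟩
        (σ u + σ (σ u)) * σ v + σ (σ u) * σ (σ v)
          ≈⟨ +-cong (*-congʳ (+-congˡ tru)) (*-cong tru trv) ⟩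
        (σ u + (u + σ u)) * σ v + (u + σ u) * (v + σ v)
          ≈⟨ solve 4 (λ u u′ v v′ → (u′ :+ (u :+ u′)) :* v′ :+ (u :+ u′) :* (v :+ v′) := (u :+ u′) :* v :+ u′ :* v′) refl u (σ u) v (σ v) ⟩
        a′ ∎) i-fixed
      b-fixed : σ b ≈ b
      b-fixed = σ.fixed-* (begin
        σ b′
          ≈⟨ trans (σ.+-homo _ _) (+-cong (σ.*-homo _ _) (σ.*-homo _ _)) ⟩
        σ (σ u) * σ v + σ u * σ (σ v)
          ≈⟨ +-cong (*-congʳ tru) (*-congˡ trv) ⟩
        (u + σ u) * σ v + σ u * (v + σ v)
          ≈⟨ solve 4 (λ u u′ v v′ → (u :+ u′) :* v′ :+ u′ :* (v :+ v′) := u′ :* v :+ u :* v′) refl u (σ u) v (σ v) ⟩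
        b′ ∎) i-fixed
      v≈ : v ≈ a * u + b * σ u
      v≈ = begin
        v
          ≈⟨ vanish v v (x≈y⇒x+y≈0 ni≈1) ⟨
        v + v * (n u (σ u) * i + 1#)
          ≈⟨ solve 5 (λ u u′ v v′ i → v :+ v :* ((u :* u :+ u :* u′ :+ u′ :* u′) :* i :+ con true) :=
               ((u :+ u′) :* v :+ u′ :* v′) :* i :* u :+ (u′ :* v :+ u :* v′) :* i :* u′) refl u (σ u) v (σ v) i ⟩
        a * u + b * σ u ∎
      σv≈ : σ v ≈ a * σ u + b * (u + σ u)
      σv≈ = begin
        σ v                                ≈⟨ σ.cong v≈ ⟩
        σ (a * u + b * σ u)                ≈⟨ trans (σ.+-homo _ _) (+-cong (σ.*-homo _ _) (σ.*-homo _ _)) ⟩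
        σ a * σ u + σ b * σ (σ u)          ≈⟨ +-cong (*-congʳ a-fixed) (*-cong b-fixed tru) ⟩
        a * σ u + b * (u + σ u)            ∎
      τv≈ : τ v ≈ A * τ u + B * τ (σ u)
      τv≈ = trans (τ.cong v≈) (trans (τ.+-homo _ _) (+-cong (τ.*-homo _ _) (τ.*-homo _ _)))
      τσv≈ : τ (σ v) ≈ A * τ (σ u) + B * (τ u + τ (σ u))
      τσv≈ = trans (τ.cong σv≈) (trans (τ.+-homo _ _)
        (+-cong (τ.*-homo _ _) (trans (τ.*-homo _ _) (*-congˡ (τ.+-homo _ _)))))
      -- The coordinates of τ v * v + τ u * u, modulo fixed elements, with respect
      -- to τ u * u and its image under σ.
      α = A * a + (A * b + B * a) + 1#
      β = B * b + (A * b + B * a)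
      α*e₁+β*e₂≈0 : α * e₁ u + β * e₂ u ≈ 0#
      α*e₁+β*e₂≈0 = begin
        α * e₁ u + β * e₂ u
          ≈⟨ solve 8 (λ u u′ U U′ a b A B →
               let g = A :* b :+ B :* a
                   v = a :* u :+ b :* u′ ; v′ = a :* u′ :+ b :* (u :+ u′)
                   V = A :* U :+ B :* U′ ; V′ = A :* U′ :+ B :* (U :+ U′) in
               (A :* a :+ g :+ con true) :* (U :* u :+ U′ :* u′) :+ (B :* b :+ g) :* (U :* u :+ U :* u′ :+ U′ :* u) :=
               (U :* u :+ U′ :* u′) :+ (V :* v :+ V′ :* v′)) refl u (σ u) (τ u) (τ (σ u)) a b A B ⟩
        e₁ u + _
          ≈⟨ +-congˡ (+-cong (*-cong τv≈ v≈) (*-cong τσv≈ σv≈)) ⟨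
        e₁ u + e₁ v
          ≈⟨ x≈y⇒x+y≈0 e₁≈ ⟩
        0# ∎
      -- The image of the previous relation under σ, which sends `e₁ u` to `e₂ u` and `e₂ u` to
      -- `e₁ u + e₂ u`. Together they form a linear system for `α` and `β` with determinant
      -- `n (e₁ u) (e₂ u)`.
      α*e₂+β*[e₁+e₂]≈0 : α * e₂ u + β * (e₁ u + e₂ u) ≈ 0#
      α*e₂+β*[e₁+e₂]≈0 = begin
        α * e₂ u + β * (e₁ u + e₂ u)
          ≈⟨ solve 8 (λ u u′ U U′ a b A B →
               let g = A :* b :+ B :* a
                   v = a :* u :+ b :* u′ ; v′ = a :* u′ :+ b :* (u :+ u′)
                   V = A :* U :+ B :* U′ ; V′ = A :* U′ :+ B :* (U :+ U′)
                   e₁ = U :* u :+ U′ :* u′ ; e₂ = U :* u :+ U :* u′ :+ U′ :* u in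
               (A :* a :+ g :+ con true) :* e₂ :+ (B :* b :+ g) :* (e₁ :+ e₂) :=
               e₂ :+ (V :* v :+ V :* v′ :+ V′ :* v)) refl u (σ u) (τ u) (τ (σ u)) a b A B ⟩
        e₂ u + _
          ≈⟨ +-congˡ (+-cong (+-cong (*-cong τv≈ v≈) (*-cong τv≈ σv≈)) (*-cong τσv≈ v≈)) ⟨
        e₂ u + e₂ v
          ≈⟨ x≈y⇒x+y≈0 e₂≈ ⟩
        0# ∎
      n-e≉0 : ¬ n (e₁ u) (e₂ u) ≈ 0#
      n-e≉0 ne≈0 = τ.nonzero nu≉0 (x*y≈0⇒y≈0 nu≉0 (trans (sym (n-e u)) ne≈0))
      α≈0 : α ≈ 0#
      -- The cofactors below, and those for `β`, are the entries of the adjugate matrix of this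
      -- system.
      α≈0 = x*y≈0⇒y≈0 n-e≉0 (begin
        n (e₁ u) (e₂ u) * α
          ≈⟨ solve 4 (λ x y α β → (x :* x :+ x :* y :+ y :* y) :* α :=
               con false :+ (x :+ y) :* (α :* x :+ β :* y) :+ y :* (α :* y :+ β :* (x :+ y))) refl (e₁ u) (e₂ u) α β ⟩
        0# + (e₁ u + e₂ u) * (α * e₁ u + β * e₂ u) + e₂ u * (α * e₂ u + β * (e₁ u + e₂ u))
          ≈⟨ trans (vanish _ _ α*e₂+β*[e₁+e₂]≈0) (vanish _ _ α*e₁+β*e₂≈0) ⟩
        0# ∎)
      β≈0 : β ≈ 0#
      β≈0 = x*y≈0⇒y≈0 n-e≉0 (begin
        n (e₁ u) (e₂ u) * β
          ≈⟨ solve 4 (λ x y α β → (x :* x :+ x :* y :+ y :* y) :* β :=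
               con false :+ y :* (α :* x :+ β :* y) :+ x :* (α :* y :+ β :* (x :+ y))) refl (e₁ u) (e₂ u) α β ⟩
        0# + e₂ u * (α * e₁ u + β * e₂ u) + e₁ u * (α * e₂ u + β * (e₁ u + e₂ u))
          ≈⟨ trans (vanish _ _ α*e₂+β*[e₁+e₂]≈0) (vanish _ _ α*e₁+β*e₂≈0) ⟩
        0# ∎)
      b≈0 : b ≈ 0#
      b≈0 = begin
        b            ≈⟨ solve 2 (λ a b → b := a :+ b :+ a) refl a b ⟩
        a + b + a    ≈⟨ x≈y⇒x+y≈0 (τa*a-injective (σ.fixed-+ a-fixed b-fixed) a-fixed same) ⟩
        0#           ∎
        where
        same : τ (a + b) * (a + b) ≈ τ a * a
        same = begin
          τ (a + b) * (a + b)   ≈⟨ *-congʳ (τ.+-homo a b) ⟩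
          (A + B) * (a + b)     ≈⟨ solve 4 (λ a b A B → (A :+ B) :* (a :+ b) := A :* a :+ con true :* (B :* b :+ (A :* b :+ B :* a))) refl a b A B ⟩
          A * a + 1# * β        ≈⟨ vanish _ _ β≈0 ⟩
          A * a                 ∎
      a≈1 : a ≈ 1#
      a≈1 = τa*a-injective a-fixed σ.1-homo (begin
        A * a                              ≈⟨ solve 4 (λ a b A B → A :* a := con true :+ con true :* (A :* a :+ (A :* b :+ B :* a) :+ con true) :+ A :* b :+ a :* B) refl a b A B ⟩
        1# + 1# * α + A * b + a * B        ≈⟨ trans (vanish _ _ (trans (τ.cong b≈0) τ.0-homo)) (trans (vanish _ _ b≈0) (vanish _ _ α≈0)) ⟩
        1#                                 ≈⟨ *-identityʳ 1# ⟨
        1# * 1#                            ≈⟨ *-congʳ τ.1-homo ⟨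
        τ 1# * 1#                          ∎)

    -- `e₁` is additive in `τ u * u`, being its image under `1 + σ`, and `1 + σ` kills fixed
    -- elements.
    e₁≈e₁ : ∀ {u v} → σ (τ u * u + τ v * v) ≈ τ u * u + τ v * v → e₁ u ≈ e₁ v
    e₁≈e₁ {u} {v} fixed = x+y≈0⇒x≈y (begin
      e₁ u + e₁ v
        ≈⟨ solve 4 (λ x y x′ y′ → (x :+ x′) :+ (y :+ y′) := (x :+ y) :+ (x′ :+ y′)) refl (τ u * u) (τ v * v) (τ (σ u) * σ u) (τ (σ v) * σ v) ⟩
      (τ u * u + τ v * v) + (τ (σ u) * σ u + τ (σ v) * σ v)
        ≈⟨ +-congˡ (+-cong (*-congʳ (στ≈τσ u)) (*-congʳ (στ≈τσ v))) ⟨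
      (τ u * u + τ v * v) + (σ (τ u) * σ u + σ (τ v) * σ v)
        ≈⟨ +-congˡ (trans (σ.+-homo _ _) (+-cong (σ.*-homo _ _) (σ.*-homo _ _))) ⟨
      (τ u * u + τ v * v) + σ (τ u * u + τ v * v)
        ≈⟨ x≈y⇒x+y≈0 (sym fixed) ⟩
      0# ∎)

    τu*u-injective-mod-fixed : ∀ {u v} → TraceZero u → TraceZero v →
      σ (τ u * u + τ v * v) ≈ τ u * u + τ v * v → u ≈ v
    τu*u-injective-mod-fixed {u} {v} tru trv fixed with n u (σ u) ≟ 0#
    ... | yes nu≈0 = isotropic nu≈0 e₁≈ e₂≈
      where
      e₁≈ = e₁≈e₁ fixed
      e₂≈ = trans (sym (e₂≈σe₁ tru)) (trans (σ.cong e₁≈) (e₂≈σe₁ trv))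
    ... | no nu≉0 = anisotropic tru trv nu≉0 e₁≈ e₂≈
      where
      e₁≈ = e₁≈e₁ fixed
      e₂≈ = trans (sym (e₂≈σe₁ tru)) (trans (σ.cong e₁≈) (e₂≈σe₁ trv))

-- Power maps and coprime exponents

module PowerMaps {a ℓ₁ ℓ₂} (K : HeytingField a ℓ₁ ℓ₂) where

  open FieldProperties K
  open SetoidReasoning setoid

  x^[1+w]≈x⇒x^w≈1 : ∀ {x} w → x ^ suc w ≈ x → ¬ x ≈ 0# → x ^ w ≈ 1#
  x^[1+w]≈x⇒x^w≈1 w x^[1+w]≈x x≉0 = *-cancelˡ x≉0 (trans x^[1+w]≈x (sym (*-identityʳ _)))

  -- Bézout gives an inverse of `N` modulo `w`. The exponent `e` is chosen before `x`, so that one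
  -- and the same power undoes the `N`-th power at two elements to be compared.
  coprime⇒root : ∀ w N → Coprime w N → ∃ λ e → ∀ {x} → x ^ w ≈ 1# → x ^ (N ℕ.* e) ≈ x
  coprime⇒root w N w⊥N with Coprimality.coprime-Bézout w⊥N
  ... | Bézout.-+ i j eq = j , λ {x} x^w≈1 → begin
    x ^ (N ℕ.* j)          ≡⟨ ≡.cong (x ^_) (ℕₚ.*-comm N j) ⟩
    x ^ (j ℕ.* N)          ≡⟨ ≡.cong (x ^_) eq ⟨
    x * x ^ (i ℕ.* w)      ≡⟨ ≡.cong (λ e → x * x ^ e) (ℕₚ.*-comm i w) ⟩
    x * x ^ (w ℕ.* i)      ≈⟨ *-congˡ (x^[m*n]≈1 w i x^w≈1) ⟩
    x * 1#                 ≈⟨ *-identityʳ x ⟩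
    x                      ∎
  -- Here x ^ (j N) is the inverse of x, and inverting twice gives x back.
  ... | Bézout.+- i j eq = j ℕ.* (j ℕ.* N) , λ {x} x^w≈1 →
    let s = j ℕ.* N
        x*x^s≈1 : x * x ^ s ≈ 1#
        x*x^s≈1 = begin
          x ^ suc s            ≡⟨ ≡.cong (x ^_) eq ⟩
          x ^ (i ℕ.* w)        ≡⟨ ≡.cong (x ^_) (ℕₚ.*-comm i w) ⟩
          x ^ (w ℕ.* i)        ≈⟨ x^[m*n]≈1 w i x^w≈1 ⟩
          1#                   ∎
        x^s≉0 : ¬ x ^ s ≈ 0#
        x^s≉0 x^s≈0 = 1≉0 (trans (sym x*x^s≈1) (trans (*-congˡ x^s≈0) (zeroʳ x)))
    in *-cancelˡ x^s≉0 (begin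
      x ^ s * x ^ (N ℕ.* (j ℕ.* s))  ≡⟨ ≡.cong (λ e → x ^ s * x ^ e) (≡.trans (≡.sym (ℕₚ.*-assoc N j s)) (≡.cong (ℕ._* s) (ℕₚ.*-comm N j))) ⟩
      x ^ s * x ^ (s ℕ.* s)          ≈⟨ *-congˡ (^-assocʳ x s s) ⟨
      x ^ s * (x ^ s) ^ s            ≈⟨ ^-distrib-* x (x ^ s) s ⟨
      (x * x ^ s) ^ s                ≈⟨ ^-congˡ s x*x^s≈1 ⟩
      1# ^ s                         ≈⟨ 1^n≈1 s ⟩
      1#                             ≈⟨ x*x^s≈1 ⟨
      x * x ^ s                      ≈⟨ *-comm x (x ^ s) ⟩
      x ^ s * x                      ∎)

  -- Let `d > 1` divide both numbers and put `M = w / d`. As `M * N` is a multiple of `w`, the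
  -- `M`-th power of each `r i` has `N`-th power one, hence is one itself. So `X^M - 1` would have
  -- `w > M` roots. Counting roots takes the place of a generator of the multiplicative group.
  injective⇒coprime : ∀ {w N} .{{_ : NonZero w}} (r : Fin w → Carrier) → Injective _≡_ _≈_ r →
    (∀ i → r i ^ w ≈ 1#) → (∀ i M → (r i ^ M) ^ N ≈ 1# → r i ^ M ≈ 1#) → Coprime w N
  injective⇒coprime {w} r r-inj root r-injective {zero} (0∣w , _) =
    contradiction (0∣⇒≡0 0∣w) (ℕ.≢-nonZero⁻¹ w)
  injective⇒coprime r r-inj root r-injective {suc zero} _ = ≡.refl
  injective⇒coprime {w} {N} r r-inj root r-injective {d@(suc (suc _))} (divides zero w≡ , _) =
    contradiction w≡ (ℕ.≢-nonZero⁻¹ w)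
  injective⇒coprime {w} {N} r r-inj root r-injective {d@(suc (suc _))} (divides M@(suc _) w≡ , divides N′ N≡) =
    contradiction all-roots (roots-of-unity-bound M (r ∘ inject) (Finₚ.inject≤-injective M<w M<w _ _ ∘ r-inj))
    where
    M<w : M ℕ.< w
    M<w = ≡.subst (M ℕ.<_) (≡.sym w≡) (ℕₚ.m<m*n M d (ℕ.s≤s (ℕ.s≤s ℕ.z≤n)))
    inject : Fin (suc M) → Fin w
    inject i = inject≤ i M<w
    M*N≡w*N′ : M ℕ.* N ≡ w ℕ.* N′
    M*N≡w*N′ = ≡.trans (≡.cong (M ℕ.*_) (≡.trans N≡ (ℕₚ.*-comm N′ d)))
      (≡.trans (≡.sym (ℕₚ.*-assoc M d N′)) (≡.cong (ℕ._* N′) (≡.sym w≡)))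
    all-roots : ∀ i → r (inject i) ^ M ≈ 1#
    all-roots i = r-injective (inject i) M (begin
      (r (inject i) ^ M) ^ N        ≈⟨ ^-assocʳ _ M N ⟩
      r (inject i) ^ (M ℕ.* N)      ≡⟨ ≡.cong (r (inject i) ^_) M*N≡w*N′ ⟩
      r (inject i) ^ (w ℕ.* N′)     ≈⟨ x^[m*n]≈1 w N′ (root (inject i)) ⟩
      1#                            ∎)

-- The map g, its trace summand, and injectivity in both directions

module TraceForm {k ℓ₁ ℓ₂} (K : HeytingField k ℓ₁ ℓ₂) (m : ℕ) (order : HasOrder K (suc m))
  (1+1≈0 : FieldProperties.CharTwo K) where

  open FieldProperties K
  open FiniteField K m order
  open CharacteristicTwo K m order 1+1≈0
  open SetoidReasoning setoid
  open Solver using (solve; _:=_; _:+_; _:*_)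

  module Setup {σ τ ρ ς : Carrier → Carrier} (σ-hom : IsEndomorphism σ) (τ-hom : IsEndomorphism τ)
    (ρ-hom : IsEndomorphism ρ) (ς-hom : IsEndomorphism ς)
    (σ³≈id : ∀ x → σ (σ (σ x)) ≈ x) (στ≈τσ : ∀ x → σ (τ x) ≈ τ (σ x))
    (σρ≈ρσ : ∀ x → σ (ρ x) ≈ ρ (σ x)) (σς≈ςσ : ∀ x → σ (ς x) ≈ ς (σ x))
    {γ : Carrier} (γ-fixed : σ γ ≈ γ) (γ≉0 : ¬ γ ≈ 0#) where

    private
      module σ = IsEndomorphism σ-hom
      module τ = IsEndomorphism τ-hom
      module ρ = IsEndomorphism ρ-hom
      module ς = IsEndomorphism ς-hom

    Fixed : Carrier → Set ℓ₁
    Fixed x = σ x ≈ x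

    Tr L ν g : Carrier → Carrier
    Tr x = x + σ x + σ (σ x)
    L x = σ x + x
    ν x = ρ x * ς x
    g x = τ (L x) * L x + γ * Tr (ν x)

    Tr-cong : ∀ {x y} → x ≈ y → Tr x ≈ Tr y
    Tr-cong x≈y = +-cong (+-cong x≈y (σ.cong x≈y)) (σ.cong (σ.cong x≈y))

    Tr-+ : ∀ x y → Tr (x + y) ≈ Tr x + Tr y
    Tr-+ x y = begin
      x + y + σ (x + y) + σ (σ (x + y))
        ≈⟨ +-cong (+-congˡ (σ.+-homo x y)) (trans (σ.cong (σ.+-homo x y)) (σ.+-homo (σ x) (σ y))) ⟩
      x + y + (σ x + σ y) + (σ (σ x) + σ (σ y))
        ≈⟨ solve 6 (λ x x′ x″ y y′ y″ → x :+ y :+ (x′ :+ y′) :+ (x″ :+ y″) := x :+ x′ :+ x″ :+ (y :+ y′ :+ y″))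
             refl x (σ x) (σ (σ x)) y (σ y) (σ (σ y)) ⟩
      Tr x + Tr y ∎

    Tr-* : ∀ {a} → Fixed a → ∀ x → Tr (a * x) ≈ a * Tr x
    Tr-* {a} a-fixed x = begin
      a * x + σ (a * x) + σ (σ (a * x))
        ≈⟨ +-cong (+-congˡ σax) (trans (σ.cong σax) (trans (σ.*-homo a (σ x)) (*-congʳ a-fixed))) ⟩
      a * x + a * σ x + a * σ (σ x)
        ≈⟨ solve 4 (λ a x y z → a :* x :+ a :* y :+ a :* z := a :* (x :+ y :+ z)) refl a x (σ x) (σ (σ x)) ⟩
      a * Tr x ∎
      where
      σax = trans (σ.*-homo a x) (*-congʳ a-fixed)

    Tr-fixed : ∀ x → Fixed (Tr x)
    Tr-fixed x = begin
      σ (x + σ x + σ (σ x))         ≈⟨ trans (σ.+-homo _ _) (+-congʳ (σ.+-homo _ _)) ⟩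
      σ x + σ (σ x) + σ (σ (σ x))   ≈⟨ +-congˡ (σ³≈id x) ⟩
      σ x + σ (σ x) + x             ≈⟨ solve 3 (λ x y z → y :+ z :+ x := x :+ y :+ z) refl x (σ x) (σ (σ x)) ⟩
      Tr x                          ∎

    Tr-of-fixed : ∀ {x} → Fixed x → Tr x ≈ x
    Tr-of-fixed {x} x-fixed = begin
      x + σ x + σ (σ x)   ≈⟨ +-cong (+-congˡ x-fixed) (trans (σ.cong x-fixed) x-fixed) ⟩
      x + x + x           ≈⟨ solve 1 (λ x → x :+ x :+ x := x) refl x ⟩
      x                   ∎

    Tr-L : ∀ x → Tr (L x) ≈ 0#
    Tr-L x = begin
      Tr (σ x + x)        ≈⟨ Tr-+ (σ x) x ⟩
      Tr (σ x) + Tr x     ≈⟨ x≈y⇒x+y≈0 σTr ⟩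
      0#                  ∎
      where
      σTr : Tr (σ x) ≈ Tr x
      σTr = trans (sym (trans (σ.+-homo _ _) (+-congʳ (σ.+-homo _ _)))) (Tr-fixed x)

    L-cong : ∀ {x y} → x ≈ y → L x ≈ L y
    L-cong x≈y = +-cong (σ.cong x≈y) x≈y

    L-of-fixed : ∀ {x} → Fixed x → L x ≈ 0#
    L-of-fixed = x≈y⇒x+y≈0

    L-* : ∀ {a} → Fixed a → ∀ x → L (a * x) ≈ a * L x
    L-* {a} a-fixed x = trans (+-congʳ (trans (σ.*-homo a x) (*-congʳ a-fixed))) (sym (distribˡ a (σ x) x))

    ν-cong : ∀ {x y} → x ≈ y → ν x ≈ ν y
    ν-cong x≈y = *-cong (ρ.cong x≈y) (ς.cong x≈y)

    ν-* : ∀ x y → ν (x * y) ≈ ν x * ν y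
    ν-* x y = trans (*-cong (ρ.*-homo x y) (ς.*-homo x y))
      (solve 4 (λ a b c d → a :* b :* (c :* d) := a :* c :* (b :* d)) refl (ρ x) (ρ y) (ς x) (ς y))

    σν≈νσ : ∀ x → σ (ν x) ≈ ν (σ x)
    σν≈νσ x = trans (σ.*-homo (ρ x) (ς x)) (*-cong (σρ≈ρσ x) (σς≈ςσ x))

    ν-fixed : ∀ {x} → Fixed x → Fixed (ν x)
    ν-fixed x-fixed = trans (σν≈νσ _) (ν-cong x-fixed)

    g-cong : ∀ {x y} → x ≈ y → g x ≈ g y
    g-cong x≈y = +-cong (*-cong (τ.cong (L-cong x≈y)) (L-cong x≈y)) (*-congˡ (Tr-cong (ν-cong x≈y)))

    -- The cross terms are `ς s` times the image of `Tr h` under ρ, and the same with ρ and ς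
    -- exchanged, so they vanish. The term `ν s` occurs three times, hence once modulo 2.
    Tr-ν-split : ∀ {h s} → Tr h ≈ 0# → Fixed s → Tr (ν (h + s)) ≈ Tr (ν h) + ν s
    Tr-ν-split {h} {s} Tr-h≈0 s-fixed = begin
      Tr (ν (h + s))
        ≈⟨ +-cong (+-congˡ (trans (σν≈νσ _) (ν-cong σ[h+s]))) (trans (σ.cong (trans (σν≈νσ _) (ν-cong σ[h+s]))) (trans (σν≈νσ _) (ν-cong σ[σh+s]))) ⟩
      ν (h + s) + ν (σ h + s) + ν (σ (σ h) + s)
        ≈⟨ +-cong (+-cong (ν-+ h) (ν-+ (σ h))) (ν-+ (σ (σ h))) ⟩
      (ρ h + ρ s) * (ς h + ς s) + (ρ (σ h) + ρ s) * (ς (σ h) + ς s) + (ρ (σ (σ h)) + ρ s) * (ς (σ (σ h)) + ς s)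
        ≈⟨ solve 8 (λ x₁ x₂ x₃ y₁ y₂ y₃ r t →
             (x₁ :+ r) :* (y₁ :+ t) :+ (x₂ :+ r) :* (y₂ :+ t) :+ (x₃ :+ r) :* (y₃ :+ t) :=
             (x₁ :* y₁ :+ x₂ :* y₂ :+ x₃ :* y₃ :+ r :* t) :+ t :* (x₁ :+ x₂ :+ x₃) :+ r :* (y₁ :+ y₂ :+ y₃))
             refl (ρ h) (ρ (σ h)) (ρ (σ (σ h))) (ς h) (ς (σ h)) (ς (σ (σ h))) (ρ s) (ς s) ⟩
      (ν h + ν (σ h) + ν (σ (σ h)) + ν s) + ς s * (ρ h + ρ (σ h) + ρ (σ (σ h))) + ρ s * (ς h + ς (σ h) + ς (σ (σ h)))
        ≈⟨ trans (vanish _ _ (Σφ≈0 ς-hom)) (vanish _ _ (Σφ≈0 ρ-hom)) ⟩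
      ν h + ν (σ h) + ν (σ (σ h)) + ν s
        ≈⟨ +-congʳ (+-cong (+-congˡ (σν≈νσ h)) (trans (σ.cong (σν≈νσ h)) (σν≈νσ (σ h)))) ⟨
      Tr (ν h) + ν s ∎
      where
      σ[h+s] : σ (h + s) ≈ σ h + s
      σ[h+s] = trans (σ.+-homo h s) (+-congˡ s-fixed)
      σ[σh+s] : σ (σ h + s) ≈ σ (σ h) + s
      σ[σh+s] = trans (σ.+-homo (σ h) s) (+-congˡ s-fixed)
      ν-+ : ∀ x → ν (x + s) ≈ (ρ x + ρ s) * (ς x + ς s)
      ν-+ x = *-cong (ρ.+-homo x s) (ς.+-homo x s)
      Σφ≈0 : ∀ {φ} → IsEndomorphism φ → φ h + φ (σ h) + φ (σ (σ h)) ≈ 0#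
      Σφ≈0 φ-hom = trans (sym (trans (+-homo _ _) (+-congʳ (+-homo _ _)))) (trans (cong Tr-h≈0) 0-homo)
        where open IsEndomorphism φ-hom

    module _ (τa*a-injective : ∀ {a b} → Fixed a → Fixed b → τ a * a ≈ τ b * b → a ≈ b)
             (ν-injective : ∀ {a b} → Fixed a → Fixed b → ν a ≈ ν b → a ≈ b) where

      open Core σ-hom τ-hom σ³≈id στ≈τσ τa*a-injective using (TraceZero; τu*u-injective-mod-fixed)

      g-injective : ∀ {x y} → g x ≈ g y → x ≈ y
      g-injective {x} {y} gx≈gy = begin
        x                    ≈⟨ split x ⟩
        h x + Tr x           ≈⟨ +-cong hx≈hy Tr-x≈Tr-y ⟩
        h y + Tr y           ≈⟨ split y ⟨
        y                    ∎
        where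
        h : Carrier → Carrier
        -- As 3 = 1 here, `Tr` is the identity on fixed elements, so this is the projection onto the
        -- kernel of `Tr` along the fixed elements.
        h x = x + Tr x
        split : ∀ x → x ≈ h x + Tr x
        split x = solve 2 (λ x t → x := x :+ t :+ t) refl x (Tr x)
        Tr-h : ∀ x → Tr (h x) ≈ 0#
        Tr-h x = trans (Tr-+ x (Tr x)) (x≈y⇒x+y≈0 (sym (Tr-of-fixed (Tr-fixed x))))
        L-traceZero : ∀ x → TraceZero (L x)
        L-traceZero x = x+y≈0⇒x≈y (trans (+-comm _ _) (Tr-L x))
        γTr : Carrier → Carrier
        γTr x = γ * Tr (ν x)
        γTr-fixed : ∀ x → Fixed (γTr x)
        γTr-fixed x = σ.fixed-* γ-fixed (Tr-fixed (ν x))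
        difference : τ (L x) * L x + τ (L y) * L y ≈ γTr x + γTr y
        difference = x+y≈0⇒x≈y (begin
          τ (L x) * L x + τ (L y) * L y + (γTr x + γTr y)
            ≈⟨ solve 4 (λ a b c d → a :+ b :+ (c :+ d) := a :+ c :+ (b :+ d)) refl _ _ _ _ ⟩
          g x + g y
            ≈⟨ x≈y⇒x+y≈0 gx≈gy ⟩
          0# ∎)
        Lx≈Ly : L x ≈ L y
        Lx≈Ly = τu*u-injective-mod-fixed (L-traceZero x) (L-traceZero y)
          (trans (σ.cong difference) (trans (σ.fixed-+ (γTr-fixed x) (γTr-fixed y)) (sym difference)))
        x+y-fixed : Fixed (x + y)
        x+y-fixed = x+y≈0⇒x≈y (begin
          σ (x + y) + (x + y)     ≈⟨ +-congʳ (σ.+-homo x y) ⟩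
          σ x + σ y + (x + y)     ≈⟨ solve 4 (λ a b c d → a :+ b :+ (c :+ d) := a :+ c :+ (b :+ d)) refl (σ x) (σ y) x y ⟩
          L x + L y               ≈⟨ x≈y⇒x+y≈0 Lx≈Ly ⟩
          0#                      ∎)
        hx≈hy : h x ≈ h y
        hx≈hy = x+y≈0⇒x≈y (begin
          x + Tr x + (y + Tr y)   ≈⟨ solve 4 (λ a b c d → a :+ b :+ (c :+ d) := a :+ c :+ (b :+ d)) refl x (Tr x) y (Tr y) ⟩
          x + y + (Tr x + Tr y)   ≈⟨ +-congˡ (Tr-+ x y) ⟨
          x + y + Tr (x + y)      ≈⟨ x≈y⇒x+y≈0 (sym (Tr-of-fixed x+y-fixed)) ⟩
          0#                      ∎)
        γTr-x≈γTr-y : γTr x ≈ γTr y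
        γTr-x≈γTr-y = x+y≈0⇒x≈y (trans (sym difference)
          (x≈y⇒x+y≈0 (*-cong (τ.cong Lx≈Ly) Lx≈Ly)))
        Trν : ∀ x → Tr (ν x) ≈ Tr (ν (h x)) + ν (Tr x)
        Trν x = trans (Tr-cong (ν-cong (split x))) (Tr-ν-split (Tr-h x) (Tr-fixed x))
        Tr-x≈Tr-y : Tr x ≈ Tr y
        Tr-x≈Tr-y = ν-injective (Tr-fixed x) (Tr-fixed y) (+-cancelˡ (Tr (ν (h x))) _ _ (begin
          Tr (ν (h x)) + ν (Tr x)   ≈⟨ Trν x ⟨
          Tr (ν x)                  ≈⟨ *-cancelˡ γ≉0 γTr-x≈γTr-y ⟩
          Tr (ν y)                  ≈⟨ Trν y ⟩
          Tr (ν (h y)) + ν (Tr y)   ≈⟨ +-congʳ (Tr-cong (ν-cong hx≈hy)) ⟨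
          Tr (ν (h x)) + ν (Tr y)   ∎))

    module _ (g-injective : ∀ {x y} → g x ≈ g y → x ≈ y) where

      ν-injective : ∀ {a b} → Fixed a → Fixed b → ν a ≈ ν b → a ≈ b
      ν-injective a-fixed b-fixed νa≈νb = g-injective (+-cong
        (*-cong (τ.cong La≈Lb) La≈Lb) (*-congˡ (Tr-cong νa≈νb)))
        where
        La≈Lb = trans (L-of-fixed a-fixed) (sym (L-of-fixed b-fixed))

      -- For `x` of trace zero, `L (a * x) = a * L x`, so `a * x` and `b * x` agree in the first
      -- summand of `g`. Adding a fixed `t` leaves `L` unchanged and adds `ν t` to the trace; taking
      -- `ν t ≈ s` makes the second summands agree too. Injectivity of `g` then yields
      -- `a * L x ≈ b * L x`.
      τa*a-injective : (∀ {s} → Fixed s → ∃ λ t → Fixed t × ν t ≈ s) → ∀ {y} → ¬ Fixed y →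
        ∀ {a b} → Fixed a → Fixed b → τ a * a ≈ τ b * b → a ≈ b
      τa*a-injective root {y} y-unfixed {a} {b} a-fixed b-fixed same = *-cancelˡ Lx≉0 (begin
        L x * a           ≈⟨ *-comm _ _ ⟩
        a * L x           ≈⟨ L[ax+t] ⟨
        L (a * x + t)     ≈⟨ L-cong (g-injective (+-cong τL*L TrνEq)) ⟩
        L (b * x)         ≈⟨ L-* b-fixed x ⟩
        b * L x           ≈⟨ *-comm _ _ ⟩
        L x * b           ∎)
        where
        -- This has trace zero and is nonzero because `y` is not fixed. A fixed element of trace
        -- zero is zero, so `L x` is nonzero as well and can be cancelled.
        x = L y
        Tr-x≈0 = Tr-L y
        Lx≉0 : ¬ L x ≈ 0#
        Lx≉0 Lx≈0 = y-unfixed (x+y≈0⇒x≈y (trans (sym (Tr-of-fixed (x+y≈0⇒x≈y Lx≈0))) Tr-x≈0))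
        s = (ν a + ν b) * Tr (ν x)
        s-fixed : Fixed s
        s-fixed = σ.fixed-* (σ.fixed-+ (ν-fixed a-fixed) (ν-fixed b-fixed)) (Tr-fixed (ν x))
        t = proj₁ (root s-fixed)
        t-fixed = proj₁ (proj₂ (root s-fixed))
        νt≈s = proj₂ (proj₂ (root s-fixed))
        L[ax+t] : L (a * x + t) ≈ a * L x
        L[ax+t] = begin
          σ (a * x + t) + (a * x + t)    ≈⟨ +-congʳ (trans (σ.+-homo (a * x) t) (+-congˡ t-fixed)) ⟩
          σ (a * x) + t + (a * x + t)    ≈⟨ solve 3 (λ u v t → u :+ t :+ (v :+ t) := u :+ v) refl _ _ _ ⟩
          L (a * x)                      ≈⟨ L-* a-fixed x ⟩
          a * L x                        ∎
        τ[aL]*aL : ∀ a → τ (a * L x) * (a * L x) ≈ τ a * a * (τ (L x) * L x)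
        τ[aL]*aL a = trans (*-congʳ (τ.*-homo a (L x)))
          (solve 4 (λ a b c d → a :* b :* (c :* d) := a :* c :* (b :* d)) refl _ _ _ _)
        τL*L : τ (L (a * x + t)) * L (a * x + t) ≈ τ (L (b * x)) * L (b * x)
        τL*L = begin
          τ (L (a * x + t)) * L (a * x + t)   ≈⟨ *-cong (τ.cong L[ax+t]) L[ax+t] ⟩
          τ (a * L x) * (a * L x)             ≈⟨ τ[aL]*aL a ⟩
          τ a * a * (τ (L x) * L x)           ≈⟨ *-congʳ same ⟩
          τ b * b * (τ (L x) * L x)           ≈⟨ τ[aL]*aL b ⟨
          τ (b * L x) * (b * L x)             ≈⟨ *-cong (τ.cong (L-* b-fixed x)) (L-* b-fixed x) ⟨
          τ (L (b * x)) * L (b * x)           ∎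
        Trν[ax] : ∀ {a} → Fixed a → Tr (ν (a * x)) ≈ ν a * Tr (ν x)
        Trν[ax] {a} a-fixed = trans (Tr-cong (ν-* a x)) (Tr-* (ν-fixed a-fixed) (ν x))
        TrνEq : γ * Tr (ν (a * x + t)) ≈ γ * Tr (ν (b * x))
        TrνEq = *-congˡ (begin
          Tr (ν (a * x + t))                             ≈⟨ Tr-ν-split (trans (Tr-* a-fixed x) (trans (*-congˡ Tr-x≈0) (zeroʳ a))) t-fixed ⟩
          Tr (ν (a * x)) + ν t                           ≈⟨ +-cong (Trν[ax] a-fixed) νt≈s ⟩
          ν a * Tr (ν x) + (ν a + ν b) * Tr (ν x)        ≈⟨ solve 3 (λ a b t → a :* t :+ (a :+ b) :* t := b :* t) refl (ν a) (ν b) (Tr (ν x)) ⟩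
          ν b * Tr (ν x)                                 ≈⟨ Trν[ax] b-fixed ⟨
          Tr (ν (b * x))                                 ∎)

-- Common divisors of 2^k - 1 and 2^j + 1, and orders at 2

module NumberTheory where

  open import Data.Integer.Base using (∣_∣)
  open import Data.Nat.Base using (_+_; _*_; _^_; _∸_; _≤_; s≤s)
  open import Relation.Binary.PropositionalEquality.Core using (refl; sym; trans; cong; cong₂; subst)
  open import Relation.Binary.PropositionalEquality.Properties using (module ≡-Reasoning)

  Odd : ℕ → Set
  Odd n = ∃ λ h → n ≡ suc (2 * h)

  even⊎odd : ∀ n → 2 ∣ n ⊎ Odd n
  even⊎odd zero    = inj₁ (2 ∣0)
  even⊎odd (suc n) with even⊎odd n
  ... | inj₁ (divides h n≡h*2) = inj₂ (h , cong suc (trans n≡h*2 (ℕₚ.*-comm h 2)))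
  ... | inj₂ (h , refl)        = inj₁ (divides (suc h) (cong (ℕ.suc ∘ ℕ.suc) (ℕₚ.*-comm 2 h)))

  odd^n : ∀ {a} → Odd a → ∀ n → Odd (a ^ n)
  odd^n odd-a zero = 0 , refl
  odd^n (h , refl) (suc n) with odd^n (h , refl) n
  ... | i , a^n≡ = i + h * suc (2 * i) , trans (cong (suc (2 * h) *_) a^n≡)
    (solve 2 (λ h i → (con 1 :+ con 2 :* h) :* (con 1 :+ con 2 :* i) :=
      con 1 :+ con 2 :* (i :+ h :* (con 1 :+ con 2 :* i))) refl h i)
    where open +-*-Solver

  odd+odd : ∀ {a b} → Odd a → Odd b → 2 ∣ a + b
  odd+odd (h , refl) (i , refl) = divides (suc (h + i))
    (solve 2 (λ h i → (con 1 :+ con 2 :* h) :+ (con 1 :+ con 2 :* i) := (con 1 :+ (h :+ i)) :* con 2) refl h i)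
    where open +-*-Solver

  odd-prime : ∀ {p} → Prime p → p ≢ 2 → Odd p
  odd-prime {p} p-prime p≢2 with even⊎odd p
  ... | inj₂ odd-p = odd-p
  ... | inj₁ 2∣p with prime⇒irreducible p-prime 2∣p
  ...   | inj₂ 2≡p = contradiction (sym 2≡p) p≢2

  coprime-* : ∀ {a b c} → Coprime a b → Coprime a c → Coprime a (b * c)
  coprime-* a⊥b a⊥c (d∣a , d∣bc) =
    a⊥c (d∣a , Coprimality.coprime-divisor (λ (e∣d , e∣b) → a⊥b (∣-trans e∣d d∣a , e∣b)) d∣bc)

  coprime-^ : ∀ {a b} → Coprime a b → ∀ n → Coprime a (b ^ n)
  coprime-^ a⊥b zero    (_ , d∣1) = ∣1⇒≡1 d∣1
  coprime-^ a⊥b (suc n) = coprime-* a⊥b (coprime-^ a⊥b n)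

  coprime-∣ : ∀ {a b c} → b ∣ c → Coprime a c → Coprime a b
  coprime-∣ b∣c a⊥c (d∣a , d∣b) = a⊥c (d∣a , ∣-trans d∣b b∣c)

  a∣[1+a]^n∸1 : ∀ a n → a ∣ suc a ^ n ∸ 1
  a∣[1+a]^n∸1 a n = divides (proj₁ (power n)) (cong (_∸ 1) (proj₂ (power n)))
    where
    open +-*-Solver
    power : ∀ n → ∃ λ t → suc a ^ n ≡ suc (t * a)
    power zero    = 0 , refl
    power (suc n) with power n
    ... | t , eq = t + suc (t * a) , trans (cong (suc a *_) eq)
      (solve 2 (λ a t → (con 1 :+ a) :* (con 1 :+ t :* a) := con 1 :+ (t :+ (con 1 :+ t :* a)) :* a) refl a t)

  a∸1∣a^n∸1 : ∀ a .{{_ : NonZero a}} n → a ∸ 1 ∣ a ^ n ∸ 1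
  a∸1∣a^n∸1 (suc a) n = a∣[1+a]^n∸1 a n

  -- Passing from the exponent to the exponent plus 2 uses a² = 1 + (a - 1)(a + 1).
  a+1∣a^[1+2n]+1 : ∀ a .{{_ : NonZero a}} n → a + 1 ∣ a ^ suc (2 * n) + 1
  a+1∣a^[1+2n]+1 a       zero    = ∣-reflexive (cong (_+ 1) (sym (ℕₚ.*-identityʳ a)))
  a+1∣a^[1+2n]+1 a@(suc b) (suc n) with a+1∣a^[1+2n]+1 a n
  ... | divides t eq = ∣m+n∣m⇒∣n (divides (a * a * t) step) (divides b refl)
    where
    open +-*-Solver
    open ≡-Reasoning
    step : b * (a + 1) + (a ^ suc (2 * suc n) + 1) ≡ a * a * t * (a + 1)
    step = begin
      b * (a + 1) + (a ^ suc (2 * suc n) + 1)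
        ≡⟨ cong (λ e → b * (a + 1) + (a ^ suc e + 1)) (ℕₚ.*-suc 2 n) ⟩
      b * (a + 1) + (a * (a * a ^ suc (2 * n)) + 1)
        ≡⟨ solve 2 (λ b y → b :* (con 1 :+ b :+ con 1) :+ ((con 1 :+ b) :* ((con 1 :+ b) :* y) :+ con 1) :=
             (con 1 :+ b) :* (con 1 :+ b) :* (y :+ con 1)) refl b (a ^ suc (2 * n)) ⟩
      a * a * (a ^ suc (2 * n) + 1)
        ≡⟨ cong (a * a *_) eq ⟩
      a * a * (t * (a + 1))
        ≡⟨ ℕₚ.*-assoc (a * a) t (a + 1) ⟨
      a * a * t * (a + 1) ∎

  a+1∣a²∸1 : ∀ a .{{_ : NonZero a}} → a + 1 ∣ a ^ 2 ∸ 1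
  a+1∣a²∸1 (suc b) = divides b (cong (_∸ 1)
    (solve 1 (λ b → (con 1 :+ b) :* ((con 1 :+ b) :* con 1) := con 1 :+ b :* (con 1 :+ b :+ con 1)) refl b))
    where open +-*-Solver

  2^-monoʳ-∣ : ∀ {m n} → m ≤ n → 2 ^ m ∣ 2 ^ n
  2^-monoʳ-∣ {m} {n} m≤n = divides (2 ^ (n ∸ m))
    (trans (cong (2 ^_) (sym (ℕₚ.m∸n+n≡m m≤n))) (ℕₚ.^-distribˡ-+-* 2 (n ∸ m) m))

  odd-2^k∸1 : ∀ k .{{_ : NonZero k}} → ¬ 2 ∣ 2 ^ k ∸ 1
  odd-2^k∸1 (suc k) 2∣q∸1 = contradiction (∣⇒≤ 2∣1) λ { (s≤s ()) }
    where
    2∣1 : 2 ∣ 1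
    2∣1 = ∣m+n∣m⇒∣n (subst (2 ∣_) (sym (ℕₚ.m∸n+n≡m (ℕₚ.m^n>0 2 (suc k)))) (m∣m*n (2 ^ k))) 2∣q∸1

  -- An even cofactor would let a higher power of 2 divide `k`.
  odd-cofactor : ∀ k .{{_ : NonZero k}} h → k ≡ h * 2 ^ maxPow₂ k → Odd h
  odd-cofactor k h k≡ with even⊎odd h
  ... | inj₂ odd-h = odd-h
  ... | inj₁ 2∣h = contradiction (maxPow₂-largest k (suc (maxPow₂ k))
          (subst (2 ^ suc (maxPow₂ k) ∣_) (sym k≡) (*-monoˡ-∣ (2 ^ maxPow₂ k) 2∣h))) ℕₚ.1+n≰n

  2^s∣j⇒coprime : ∀ k .{{_ : NonZero k}} j → 2 ^ maxPow₂ k ∣ j → Coprime (2 ^ k ∸ 1) (2 ^ j + 1)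
  2^s∣j⇒coprime k j (divides j′ j≡) {d} (d∣q∸1 , d∣Q+1) with maxPow₂-divides k
  ... | divides k′ k≡ with odd-cofactor k k′ k≡
  ...   | (h , k′≡) = d≡1
    where
    s E : ℕ
    s = 2 ^ maxPow₂ k
    -- A power of `2 ^ k` and also an odd power of `2 ^ j`, so `d` divides both `E ∸ 1` and `E + 1`.
    E = 2 ^ (j * k′)
    k*j′≡j*k′ : k * j′ ≡ j * k′
    k*j′≡j*k′ = trans (cong (_* j′) k≡) (trans
      (solve 3 (λ x s y → x :* s :* y := y :* s :* x) refl k′ s j′) (cong (_* k′) (sym j≡)))
      where open +-*-Solver
    d∣E∸1 : d ∣ E ∸ 1
    d∣E∸1 = ∣-trans d∣q∸1 (subst (λ e → 2 ^ k ∸ 1 ∣ e ∸ 1)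
      (trans (ℕₚ.^-*-assoc 2 k j′) (cong (2 ^_) k*j′≡j*k′)) (a∸1∣a^n∸1 (2 ^ k) {{ℕₚ.m^n≢0 2 k}} j′))
    d∣E+1 : d ∣ E + 1
    d∣E+1 = ∣-trans d∣Q+1 (subst (λ e → 2 ^ j + 1 ∣ e + 1)
      (trans (cong ((2 ^ j) ^_) (sym k′≡)) (ℕₚ.^-*-assoc 2 j k′)) (a+1∣a^[1+2n]+1 (2 ^ j) {{ℕₚ.m^n≢0 2 j}} h))
    d∣2 : d ∣ 2
    d∣2 = ∣m+n∣m⇒∣n (subst (d ∣_) (trans (cong (_+ 1) (sym (ℕₚ.m∸n+n≡m (ℕₚ.m^n>0 2 (j * k′)))))
      (ℕₚ.+-assoc (E ∸ 1) 1 1)) d∣E+1) d∣E∸1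
    d≡1 : d ≡ 1
    d≡1 with prime⇒irreducible prime[2] d∣2
    ... | inj₁ d≡1  = d≡1
    ... | inj₂ refl = contradiction d∣q∸1 (odd-2^k∸1 k)

  coprime⇒2^s∣j : ∀ k .{{_ : NonZero k}} j → Coprime (2 ^ k ∸ 1) (2 ^ j + 1) → 2 ^ maxPow₂ k ∣ j
  -- Kept apart because `maxPow₂ 0` is not the order of zero, and the argument below compares with
  -- `maxPow₂ j`.
  coprime⇒2^s∣j k zero      _ = (2 ^ maxPow₂ k) ∣0
  coprime⇒2^s∣j k j@(suc _) ⊥ with maxPow₂ k ℕₚ.≤? maxPow₂ j
  ... | yes s≤t = ∣-trans (2^-monoʳ-∣ s≤t) (maxPow₂-divides j)
  ... | no s≰t with maxPow₂-divides j
  ...   | divides j′ j≡ with odd-cofactor j j′ j≡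
  ...     | h , j′≡ = contradiction (⊥ (G∣q∸1 , G∣Q+1)) G≢1
    where
    open ≡-Reasoning
    t D G : ℕ
    t = maxPow₂ j
    D = 2 ^ (2 ^ t)
    -- A Fermat number. It divides `2 ^ j + 1` because `2 ^ j` is an odd power of `D`, and
    -- `2 ^ k ∸ 1` because `2 ^ k` is a power of `D ^ 2`.
    G = D + 1
    D≢0 : NonZero D
    D≢0 = ℕₚ.m^n≢0 2 (2 ^ t)
    G≢1 : G ≢ 1
    G≢1 G≡1 = ℕₚ.<⇒≢ (ℕₚ.m^n>0 2 (2 ^ t)) (sym (ℕₚ.+-cancelʳ-≡ 1 D 0 G≡1))
    G∣Q+1 : G ∣ 2 ^ j + 1
    G∣Q+1 = subst (λ e → G ∣ e + 1) (begin
      D ^ suc (2 * h)      ≡⟨ cong (D ^_) (sym j′≡) ⟩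
      D ^ j′               ≡⟨ ℕₚ.^-*-assoc 2 (2 ^ t) j′ ⟩
      2 ^ (2 ^ t * j′)     ≡⟨ cong (2 ^_) (trans (ℕₚ.*-comm (2 ^ t) j′) (sym j≡)) ⟩
      2 ^ j                ∎) (a+1∣a^[1+2n]+1 D {{D≢0}} h)
    2^[1+t]∣k : 2 ^ suc t ∣ k
    2^[1+t]∣k = ∣-trans (2^-monoʳ-∣ (ℕₚ.≰⇒> s≰t)) (maxPow₂-divides k)
    G∣q∸1 : G ∣ 2 ^ k ∸ 1
    G∣q∸1 with 2^[1+t]∣k
    ... | divides k″ k≡ = ∣-trans (a+1∣a²∸1 D {{D≢0}}) (subst (λ e → D ^ 2 ∸ 1 ∣ e ∸ 1) (begin
      (D ^ 2) ^ k″             ≡⟨ ℕₚ.^-*-assoc D 2 k″ ⟩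
      D ^ (2 * k″)             ≡⟨ ℕₚ.^-*-assoc 2 (2 ^ t) (2 * k″) ⟩
      2 ^ (2 ^ t * (2 * k″))   ≡⟨ cong (2 ^_) (trans (solve 2 (λ x y → x :* (con 2 :* y) := y :* (con 2 :* x)) refl (2 ^ t) k″) (sym k≡)) ⟩
      2 ^ k                    ∎) (a∸1∣a^n∸1 (D ^ 2) {{ℕₚ.m^n≢0 D 2 {{D≢0}}}} k″))
      where open +-*-Solver

  2^m+2^n≡2^m*[2^[n∸m]+1] : ∀ {m n} → m ≤ n → 2 ^ m + 2 ^ n ≡ 2 ^ m * (2 ^ (n ∸ m) + 1)
  2^m+2^n≡2^m*[2^[n∸m]+1] {m} {n} m≤n = begin
    2 ^ m + 2 ^ n                     ≡⟨ cong₂ (λ x y → x + 2 ^ y) (sym (ℕₚ.*-identityʳ (2 ^ m))) (sym (ℕₚ.m+[n∸m]≡n m≤n)) ⟩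
    2 ^ m * 1 + 2 ^ (m + (n ∸ m))     ≡⟨ cong (λ e → 2 ^ m * 1 + e) (ℕₚ.^-distribˡ-+-* 2 m (n ∸ m)) ⟩
    2 ^ m * 1 + 2 ^ m * 2 ^ (n ∸ m)   ≡⟨ ℕₚ.*-distribˡ-+ (2 ^ m) 1 _ ⟨
    2 ^ m * (1 + 2 ^ (n ∸ m))         ≡⟨ cong (2 ^ m *_) (ℕₚ.+-comm 1 (2 ^ (n ∸ m))) ⟩
    2 ^ m * (2 ^ (n ∸ m) + 1)         ∎
    where open ≡-Reasoning

  -- Taking out the smaller power brings R + S to the shape treated above, and the power taken out
  -- is coprime to the odd number q - 1.
  2^m+2^n : ∀ m n → ∃ λ i → 2 ^ m + 2 ^ n ≡ 2 ^ i * (2 ^ ∣ + m ℤ.- + n ∣ + 1)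
  2^m+2^n m n with ℕₚ.≤-total m n
  ... | inj₁ m≤n = m , trans (2^m+2^n≡2^m*[2^[n∸m]+1] m≤n) (cong (λ d → 2 ^ m * (2 ^ d + 1)) (begin
    n ∸ m                ≡⟨ ℤₚ.∣-i∣≡∣i∣ (+ (n ∸ m)) ⟨
    ∣ ℤ.- + (n ∸ m) ∣    ≡⟨ cong ∣_∣ (ℤₚ.⊖-≤ m≤n) ⟨
    ∣ m ℤ.⊖ n ∣          ≡⟨ cong ∣_∣ (ℤₚ.m-n≡m⊖n m n) ⟨
    ∣ + m ℤ.- + n ∣      ∎))
    where open ≡-Reasoning
  ... | inj₂ n≤m = n , trans (ℕₚ.+-comm (2 ^ m) (2 ^ n)) (trans (2^m+2^n≡2^m*[2^[n∸m]+1] n≤m)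
    (cong (λ d → 2 ^ n * (2 ^ d + 1)) (begin
    m ∸ n                ≡⟨ cong ∣_∣ (ℤₚ.⊖-≥ n≤m) ⟨
    ∣ m ℤ.⊖ n ∣          ≡⟨ cong ∣_∣ (ℤₚ.m-n≡m⊖n m n) ⟨
    ∣ + m ℤ.- + n ∣      ∎)))
    where open ≡-Reasoning

  -- Divisibility also handles an infinite order: everything divides zero, just as everything lies
  -- below the top element.
  ord₂≤ord₂⇔ : ∀ k .{{_ : NonZero k}} N → ord₂ (+ k) ≤∞ ord₂ N ⇔ 2 ^ maxPow₂ k ∣ ∣ N ∣
  ord₂≤ord₂⇔ k@(suc _) +0 = mk⇔ (λ _ → _ ∣0) (λ _ → _ Supremum.≤⊤⁺)
  ord₂≤ord₂⇔ k@(suc _) +[1+ n ] = mk⇔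
    (λ { Supremum.[ s≤t ] → ∣-trans (2^-monoʳ-∣ s≤t) (maxPow₂-divides (suc n)) })
    (λ 2^s∣n → Supremum.[ maxPow₂-largest (suc n) (maxPow₂ k) 2^s∣n ])
  ord₂≤ord₂⇔ k@(suc _) -[1+ n ] = mk⇔
    (λ { Supremum.[ s≤t ] → ∣-trans (2^-monoʳ-∣ s≤t) (maxPow₂-divides (suc n)) })
    (λ 2^s∣n → Supremum.[ maxPow₂-largest (suc n) (maxPow₂ k) 2^s∣n ])

  coprime⇔ord₂ : ∀ k .{{_ : NonZero k}} ℓ m n →
    Coprime (2 ^ k ∸ 1) ((2 ^ ℓ + 1) * (2 ^ m + 2 ^ n)) ⇔
    ord₂ (+ k) ≤∞ min∞ (ord₂ (+ ℓ)) (ord₂ (+ m ℤ.- + n))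
  coprime⇔ord₂ k ℓ m n = mk⇔ necessary sufficient
    where
    open Equivalence using (to; from)
    open NaturalMin ℕ∞-totalOrder using (⊓-glb; x≤y⊓z⇒x≤y; x≤y⊓z⇒x≤z)
    m-n = + m ℤ.- + n
    i = proj₁ (2^m+2^n m n)
    R+S≡ = proj₂ (2^m+2^n m n)
    necessary : Coprime (2 ^ k ∸ 1) ((2 ^ ℓ + 1) * (2 ^ m + 2 ^ n)) →
                ord₂ (+ k) ≤∞ min∞ (ord₂ (+ ℓ)) (ord₂ m-n)
    necessary q∸1⊥ = ⊓-glb
      (from (ord₂≤ord₂⇔ k (+ ℓ)) (coprime⇒2^s∣j k ℓ (coprime-∣ (m∣m*n (2 ^ m + 2 ^ n)) q∸1⊥)))
      (from (ord₂≤ord₂⇔ k m-n) (coprime⇒2^s∣j k ∣ m-n ∣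
        (coprime-∣ (∣n⇒∣m*n (2 ^ ℓ + 1) (divides (2 ^ i) R+S≡)) q∸1⊥)))
    2⊥q∸1 : Coprime (2 ^ k ∸ 1) 2
    2⊥q∸1 (d∣q∸1 , d∣2) with prime⇒irreducible prime[2] d∣2
    ... | inj₁ d≡1  = d≡1
    ... | inj₂ refl = contradiction d∣q∸1 (odd-2^k∸1 k)
    sufficient : ord₂ (+ k) ≤∞ min∞ (ord₂ (+ ℓ)) (ord₂ m-n) →
                 Coprime (2 ^ k ∸ 1) ((2 ^ ℓ + 1) * (2 ^ m + 2 ^ n))
    sufficient s≤min = coprime-*
      (2^s∣j⇒coprime k ℓ (to (ord₂≤ord₂⇔ k (+ ℓ)) (x≤y⊓z⇒x≤y (ord₂ (+ ℓ)) (ord₂ m-n) s≤min)))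
      (subst (Coprime (2 ^ k ∸ 1)) (sym R+S≡) (coprime-* (coprime-^ 2⊥q∸1 i)
        (2^s∣j⇒coprime k ∣ m-n ∣ (to (ord₂≤ord₂⇔ k m-n) (x≤y⊓z⇒x≤z (ord₂ (+ ℓ)) (ord₂ m-n) s≤min)))))

  odd⇒2∣∸1 : ∀ {a} → Odd a → 2 ∣ a ∸ 1
  odd⇒2∣∸1 (h , refl) = m∣m*n h

open import Data.Integer.Base using (_-_)
open import Data.Nat.Base using (_+_; _*_; _∸_; _^_; _<_)
open NumberTheory

-- Characteristic and field embedding

module Characteristic {a ℓ₁ ℓ₂} (K : HeytingField a ℓ₁ ℓ₂) (m : ℕ) (order : HasOrder K (suc m)) where

  open FieldProperties K renaming (_+_ to _+ᴷ_; _*_ to _*ᴷ_; _^_ to _^ᴷ_)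
  open FiniteField K m order
  open SetoidReasoning setoid

  [a^n]·1≈[a·1]^n : ∀ a n → (a ^ n) · 1# ≈ (a · 1#) ^ᴷ n
  [a^n]·1≈[a·1]^n a zero    = +-identityʳ 1#
  [a^n]·1≈[a·1]^n a (suc n) = trans (×1-homo-* a (a ^ n)) (*-congˡ ([a^n]·1≈[a·1]^n a n))

  -- The order times `1#` is zero and equals the `j`-th power of `1# + 1#`, and a field has no
  -- nonzero nilpotent elements.
  1+1≈0 : ∀ j → suc m ≡ 2 ^ j → 1# +ᴷ 1# ≈ 0#
  1+1≈0 j 1+m≡2^j = x^n≈0⇒x≈0 j (begin
    (1# +ᴷ 1#) ^ᴷ j            ≈⟨ ^-congˡ j (+-congˡ (+-identityʳ 1#)) ⟨
    (2 · 1#) ^ᴷ j              ≈⟨ [a^n]·1≈[a·1]^n 2 j ⟨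
    (2 ^ j) · 1#               ≡⟨ ≡.cong (_· 1#) 1+m≡2^j ⟨
    suc m · 1#                 ≈⟨ 1+m×1≈0 ⟩
    0#                         ∎)

  1+1≉0 : Odd (suc m) → ¬ 1# +ᴷ 1# ≈ 0#
  1+1≉0 (h , 1+m≡1+2h) 1+1≈0 = 1≉0 (begin
    1#                         ≈⟨ +-identityʳ 1# ⟨
    1# +ᴷ 0#                   ≈⟨ +-congˡ (zeroˡ (h · 1#)) ⟨
    1# +ᴷ 0# *ᴷ (h · 1#)       ≈⟨ +-congˡ (*-congʳ (trans (+-congˡ (+-identityʳ 1#)) 1+1≈0)) ⟨
    1# +ᴷ (2 · 1#) *ᴷ (h · 1#) ≈⟨ +-congˡ (×1-homo-* 2 h) ⟨
    suc (2 * h) · 1#           ≡⟨ ≡.cong (_· 1#) 1+m≡1+2h ⟨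
    suc m · 1#                 ≈⟨ 1+m×1≈0 ⟩
    0#                         ∎)

module Extension {a₁ ℓ₁ ℓ₁′ a₂ ℓ₂ ℓ₂′} (F : HeytingField a₁ ℓ₁ ℓ₁′) (K : HeytingField a₂ ℓ₂ ℓ₂′)
  (ι : HeytingField.Carrier F → HeytingField.Carrier K)
  (ι-hom : IsRingHomomorphism (fieldRawRing F) (fieldRawRing K) ι) where

  private module F = FieldProperties F
  open FieldProperties K renaming (_+_ to _+ᴷ_; _*_ to _*ᴷ_; _-_ to _-ᴷ_; -_ to -ᴷ_; _^_ to _^ᴷ_)
  open IsRingHomomorphism ι-hom using (⟦⟧-cong; +-homo; *-homo; -‿homo; 0#-homo; 1#-homo)
  open SetoidReasoning setoid

  ι-^ : ∀ x n → ι (x F.^ n) ≈ ι x ^ᴷ n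
  ι-^ x zero    = 1#-homo
  ι-^ x (suc n) = trans (*-homo x (x F.^ n)) (*-congˡ (ι-^ x n))

  module _ (w : ℕ) (orderF : HasOrder F (suc w)) where

    open FiniteField F w orderF

    ι≈0⇒≈0 : ∀ {x} → ι x ≈ 0# → x F.≈ F.0#
    ι≈0⇒≈0 {x} ιx≈0 with x ≟ F.0#
    ... | yes x≈0 = x≈0
    ... | no  x≉0 = let i , xi≈1 = inverse x≉0 in contradiction (begin
      1#              ≈⟨ 1#-homo ⟨
      ι F.1#          ≈⟨ ⟦⟧-cong xi≈1 ⟨
      ι (x F.* i)     ≈⟨ *-homo x i ⟩
      ι x *ᴷ ι i      ≈⟨ *-congʳ ιx≈0 ⟩
      0# *ᴷ ι i       ≈⟨ zeroˡ (ι i) ⟩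
      0#              ∎) 1≉0

    ι-injective : ∀ {x y} → ι x ≈ ι y → x F.≈ y
    ι-injective {x} {y} ιx≈ιy = F.x∙y⁻¹≈ε⇒x≈y x y (ι≈0⇒≈0 (begin
      ι (x F.- y)         ≈⟨ trans (+-homo x (F.- y)) (+-congˡ (-‿homo y)) ⟩
      ι x +ᴷ -ᴷ ι y       ≈⟨ +-congʳ ιx≈ιy ⟩
      ι y -ᴷ ι y          ≈⟨ -‿inverseʳ (ι y) ⟩
      0#                  ∎))

    ι-fixed : ∀ x → ι x ^ᴷ suc w ≈ ι x
    ι-fixed x = trans (sym (ι-^ x (suc w))) (⟦⟧-cong (x^[1+m]≈x x))

-- Odd p: f does not permute

module OddCharacteristic {a₁ ℓ₁ ℓ₁′ a₂ ℓ₂ ℓ₂′} (F : HeytingField a₁ ℓ₁ ℓ₁′) (K : HeytingField a₂ ℓ₂ ℓ₂′)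
  (ι : HeytingField.Carrier F → HeytingField.Carrier K)
  (ι-hom : IsRingHomomorphism (fieldRawRing F) (fieldRawRing K) ι) where

  open FieldProperties K renaming (_+_ to _+ᴷ_; _*_ to _*ᴷ_; _-_ to _-ᴷ_; -_ to -ᴷ_; _^_ to _^ᴷ_)
  open Evaluation F K ι ι-hom using (ev; ev-f)
  open SetoidReasoning setoid

  [-1]^even : ∀ {n} → 2 ∣ n → (-ᴷ 1#) ^ᴷ n ≈ 1#
  [-1]^even (divides h ≡.refl) = begin
    (-ᴷ 1#) ^ᴷ (h * 2)       ≡⟨ ≡.cong ((-ᴷ 1#) ^ᴷ_) (ℕₚ.*-comm h 2) ⟩
    (-ᴷ 1#) ^ᴷ (2 * h)       ≈⟨ x^[m*n]≈1 2 h square ⟩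
    1#                       ∎
    where
    square : (-ᴷ 1#) ^ᴷ 2 ≈ 1#
    square = begin
      -ᴷ 1# *ᴷ (-ᴷ 1# *ᴷ 1#)   ≈⟨ *-congˡ (*-identityʳ (-ᴷ 1#)) ⟩
      -ᴷ 1# *ᴷ -ᴷ 1#           ≈⟨ -1*x≈-x (-ᴷ 1#) ⟩
      -ᴷ -ᴷ 1#                 ≈⟨ -‿involutive 1# ⟩
      1#                       ∎

  -- Both points are roots of `X^q - X`, so the first summand agrees; the remaining exponents are
  -- multiples of the even number `R + S`.
  ev-f-1 : ∀ q Q R S c → Odd q → 2 ∣ R + S → ev (f F q Q R S c) (-ᴷ 1#) ≈ ev (f F q Q R S c) 1#
  ev-f-1 q Q R S c odd-q 2∣R+S = begin
    ev (f F q Q R S c) (-ᴷ 1#)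
      ≈⟨ ev-f q Q R S c (-ᴷ 1#) ⟩
    ((-ᴷ 1#) ^ᴷ q -ᴷ -ᴷ 1#) ^ᴷ (Q + 1) +ᴷ ι c *ᴷ (-ᴷ 1#) ^ᴷ (q ^ 2 * (R + S))
      +ᴷ ι c *ᴷ (-ᴷ 1#) ^ᴷ (q * (R + S)) +ᴷ ι c *ᴷ (-ᴷ 1#) ^ᴷ (R + S)
      ≈⟨ +-cong (+-cong (+-cong (^-congˡ (Q + 1) [-1]^q-[-1]≈1^q-1)
           (same (q ^ 2 * (R + S)) (∣n⇒∣m*n (q ^ 2) 2∣R+S))) (same (q * (R + S)) (∣n⇒∣m*n q 2∣R+S))) (same (R + S) 2∣R+S) ⟩
    (1# ^ᴷ q -ᴷ 1#) ^ᴷ (Q + 1) +ᴷ ι c *ᴷ 1# ^ᴷ (q ^ 2 * (R + S))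
      +ᴷ ι c *ᴷ 1# ^ᴷ (q * (R + S)) +ᴷ ι c *ᴷ 1# ^ᴷ (R + S)
      ≈⟨ ev-f q Q R S c 1# ⟨
    ev (f F q Q R S c) 1# ∎
    where
    same : ∀ n → 2 ∣ n → ι c *ᴷ (-ᴷ 1#) ^ᴷ n ≈ ι c *ᴷ 1# ^ᴷ n
    same n 2∣n = *-congˡ (trans ([-1]^even 2∣n) (sym (1^n≈1 n)))
    [-1]^q≈-1 : (-ᴷ 1#) ^ᴷ q ≈ -ᴷ 1#
    [-1]^q≈-1 = trans (reflexive (≡.cong ((-ᴷ 1#) ^ᴷ_) (proj₂ odd-q)))
      (trans (*-congˡ ([-1]^even (m∣m*n (proj₁ odd-q)))) (*-identityʳ (-ᴷ 1#)))
    [-1]^q-[-1]≈1^q-1 : (-ᴷ 1#) ^ᴷ q -ᴷ -ᴷ 1# ≈ 1# ^ᴷ q -ᴷ 1#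
    [-1]^q-[-1]≈1^q-1 = begin
      (-ᴷ 1#) ^ᴷ q -ᴷ -ᴷ 1#   ≈⟨ +-congʳ [-1]^q≈-1 ⟩
      -ᴷ 1# -ᴷ -ᴷ 1#          ≈⟨ -‿inverseʳ (-ᴷ 1#) ⟩
      0#                      ≈⟨ -‿inverseʳ 1# ⟨
      1# -ᴷ 1#                ≈⟨ +-congʳ (1^n≈1 q) ⟨
      1# ^ᴷ q -ᴷ 1#           ∎

  ¬permutes : ∀ q Q R S c → ¬ 1# +ᴷ 1# ≈ 0# → Odd q → 2 ∣ R + S → ¬ Permutes K (map ι (f F q Q R S c))
  ¬permutes q Q R S c 1+1≉0 odd-q 2∣R+S (injective , _) = 1+1≉0 (begin
    1# +ᴷ 1#      ≈⟨ +-congʳ (injective (ev-f-1 q Q R S c odd-q 2∣R+S)) ⟨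
    -ᴷ 1# +ᴷ 1#   ≈⟨ -‿inverseˡ 1# ⟩
    0#            ∎)

-- p = 2: permutation and coprimality

module EvenCharacteristic {a₁ ℓ₁ ℓ₁′ a₂ ℓ₂ ℓ₂′} (k ℓ m n : ℕ) .{{_ : NonZero k}}
  (F : HeytingField a₁ ℓ₁ ℓ₁′) (orderF : HasOrder F (2 ^ k))
  (K : HeytingField a₂ ℓ₂ ℓ₂′) (orderK : HasOrder K ((2 ^ k) ^ 3))
  (ι : HeytingField.Carrier F → HeytingField.Carrier K)
  (ι-hom : IsRingHomomorphism (fieldRawRing F) (fieldRawRing K) ι)
  (c : HeytingField.Carrier F) (c≉0 : ¬ HeytingField._≈_ F c (HeytingField.0# F)) where

  q Q R S w v : ℕ
  q = 2 ^ k
  Q = 2 ^ ℓ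
  R = 2 ^ m
  S = 2 ^ n
  w = q ∸ 1
  v = q ^ 3 ∸ 1

  2≤q : 2 ℕ.≤ q
  2≤q = ℕₚ.≤-trans (ℕₚ.≤-reflexive (≡.sym (ℕₚ.*-identityʳ 2))) (ℕₚ.^-monoʳ-≤ 2 (ℕ.>-nonZero⁻¹ k))

  1+w≡q : suc w ≡ q
  1+w≡q = ℕₚ.m+[n∸m]≡n (ℕₚ.m^n>0 2 k)

  q^3≡2^[k*3] : q ^ 3 ≡ 2 ^ (k * 3)
  q^3≡2^[k*3] = ℕₚ.^-*-assoc 2 k 3

  1+v≡q^3 : suc v ≡ q ^ 3
  1+v≡q^3 = ℕₚ.m+[n∸m]≡n (≡.subst (1 ℕ.≤_) (≡.sym q^3≡2^[k*3]) (ℕₚ.m^n>0 2 (k * 3)))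

  instance
    w≢0 : NonZero w
    w≢0 = ℕ.>-nonZero (ℕₚ.m<n⇒0<n∸m 2≤q)

  -- Provides `q` distinct nonzero elements of K, one more than `X^w - 1` can have as roots.
  1+w≤v : suc w ℕ.≤ v
  1+w≤v = ℕ.s≤s⁻¹ (begin
    suc (suc w)        ≡⟨ ≡.cong suc 1+w≡q ⟩
    1 + q              ≤⟨ ℕₚ.+-monoˡ-≤ q (ℕₚ.m^n>0 2 k) ⟩
    q + q              ≡⟨ ≡.cong (λ e → q + e) (ℕₚ.+-identityʳ q) ⟨
    2 * q              ≡⟨ ℕₚ.*-comm 2 q ⟩
    q * 2              ≤⟨ ℕₚ.*-monoʳ-≤ q 2≤q ⟩
    q * q              ≤⟨ ℕₚ.m≤m*n (q * q) q {{ℕₚ.m^n≢0 2 k}} ⟩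
    q * q * q          ≡⟨ ℕₚ.*-assoc q q q ⟩
    q * (q * q)        ≡⟨ ≡.cong (λ e → q * (q * e)) (ℕₚ.*-identityʳ q) ⟨
    q ^ 3              ≡⟨ 1+v≡q^3 ⟨
    suc v              ∎)
    where open ℕₚ.≤-Reasoning

  orderF′ : HasOrder F (suc w)
  orderF′ = ≡.subst (HasOrder F) (≡.sym 1+w≡q) orderF

  orderK′ : HasOrder K (suc v)
  orderK′ = ≡.subst (HasOrder K) (≡.sym 1+v≡q^3) orderK

  open FieldProperties K renaming (_+_ to _+ᴷ_; _*_ to _*ᴷ_; _-_ to _-ᴷ_; _^_ to _^ᴷ_)
  module FF = FiniteField F w orderF′
  open FiniteField K v orderK′
  open Extension F K ι ι-hom
  open Evaluation F K ι ι-hom using (ev; ev-f; ev-cong)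
  open PowerMaps K

  2≈0 : 1# +ᴷ 1# ≈ 0#
  2≈0 = Characteristic.1+1≈0 K v orderK′ (k * 3) (≡.trans 1+v≡q^3 q^3≡2^[k*3])

  open CharacteristicTwo K v orderK′ 2≈0
  open SetoidReasoning setoid

  σ τ : Carrier → Carrier
  σ x = x ^ᴷ q
  τ x = x ^ᴷ Q

  σ³≈id : ∀ x → σ (σ (σ x)) ≈ x
  σ³≈id x = begin
    ((x ^ᴷ q) ^ᴷ q) ^ᴷ q     ≈⟨ ^-congˡ q (^-assocʳ x q q) ⟩
    (x ^ᴷ (q * q)) ^ᴷ q      ≈⟨ ^-assocʳ x (q * q) q ⟩
    x ^ᴷ (q * q * q)         ≡⟨ ≡.cong (x ^ᴷ_) (≡.trans (ℕₚ.*-assoc q q q) (≡.cong (λ e → q * (q * e)) (≡.sym (ℕₚ.*-identityʳ q)))) ⟩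
    x ^ᴷ (q ^ 3)             ≡⟨ ≡.cong (x ^ᴷ_) 1+v≡q^3 ⟨
    x ^ᴷ suc v               ≈⟨ x^[1+m]≈x x ⟩
    x                        ∎

  ^-commute : ∀ i j x → (x ^ᴷ j) ^ᴷ i ≈ (x ^ᴷ i) ^ᴷ j
  ^-commute i j x = begin
    (x ^ᴷ j) ^ᴷ i   ≈⟨ ^-assocʳ x j i ⟩
    x ^ᴷ (j * i)    ≡⟨ ≡.cong (x ^ᴷ_) (ℕₚ.*-comm j i) ⟩
    x ^ᴷ (i * j)    ≈⟨ ^-assocʳ x i j ⟨
    (x ^ᴷ i) ^ᴷ j   ∎

  γ : Carrier
  γ = ι c

  ι-fixed-by-σ : ∀ x → σ (ι x) ≈ ι x
  ι-fixed-by-σ x = ≡.subst (λ e → ι x ^ᴷ e ≈ ι x) 1+w≡q (ι-fixed w orderF′ x)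

  γ≉0 : ¬ γ ≈ 0#
  γ≉0 = c≉0 ∘ ι≈0⇒≈0 w orderF′

  open TraceForm K v orderK′ 2≈0
  open Setup (x^2^i-isEndomorphism k) (x^2^i-isEndomorphism ℓ) (x^2^i-isEndomorphism m) (x^2^i-isEndomorphism n)
    σ³≈id (^-commute q Q) (^-commute q R) (^-commute q S) (ι-fixed-by-σ c) γ≉0

  ν≈^ : ∀ x → ν x ≈ x ^ᴷ (R + S)
  ν≈^ x = sym (^-homo-* x R S)

  τx*x≈^ : ∀ x → τ x *ᴷ x ≈ x ^ᴷ (Q + 1)
  τx*x≈^ x = sym (trans (^-homo-* x Q 1) (*-congˡ (*-identityʳ x)))

  φ : Carrier → Carrier
  φ = ev (f F q Q R S c)

  -- Raising to `q^i (R + S)` is the `i`-th iterate of σ after `ν`, so the three monomials add up to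
  -- a trace; the sign in `X^q - X` disappears modulo 2.
  φ≈g : ∀ x → φ x ≈ g x
  φ≈g x = begin
    φ x
      ≈⟨ ev-f q Q R S c x ⟩
    (σ x -ᴷ x) ^ᴷ (Q + 1) +ᴷ γ *ᴷ x ^ᴷ (q ^ 2 * N) +ᴷ γ *ᴷ x ^ᴷ (q * N) +ᴷ γ *ᴷ x ^ᴷ N
      ≈⟨ +-cong (+-cong (+-cong (trans (^-congˡ (Q + 1) (+-congˡ (-x≈x x))) (sym (τx*x≈^ (L x))))
           (*-congˡ (trans power₂ (σ.cong (σ.cong (sym (ν≈^ x))))))) (*-congˡ (trans power₁ (σ.cong (sym (ν≈^ x)))))) (*-congˡ (sym (ν≈^ x))) ⟩
    τ (L x) *ᴷ L x +ᴷ γ *ᴷ σ (σ (ν x)) +ᴷ γ *ᴷ σ (ν x) +ᴷ γ *ᴷ ν x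
      ≈⟨ solve 5 (λ a γ y₂ y₁ y₀ → a :+ γ :* y₂ :+ γ :* y₁ :+ γ :* y₀ := a :+ γ :* (y₀ :+ y₁ :+ y₂)) refl (τ (L x) *ᴷ L x) γ (σ (σ (ν x))) (σ (ν x)) (ν x) ⟩
    g x ∎
    where
    open Solver using (solve; _:=_; _:+_; _:*_)
    module σ = IsEndomorphism (x^2^i-isEndomorphism k)
    N = R + S
    power₁ : x ^ᴷ (q * N) ≈ σ (x ^ᴷ N)
    power₁ = trans (reflexive (≡.cong (x ^ᴷ_) (ℕₚ.*-comm q N))) (sym (^-assocʳ x N q))
    power₂ : x ^ᴷ (q ^ 2 * N) ≈ σ (σ (x ^ᴷ N))
    power₂ = begin
      x ^ᴷ (q ^ 2 * N)       ≡⟨ ≡.cong (x ^ᴷ_) (≡.trans (ℕₚ.*-comm (q ^ 2) N) (≡.trans (≡.cong (λ e → N * (q * e)) (ℕₚ.*-identityʳ q)) (≡.sym (ℕₚ.*-assoc N q q)))) ⟩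
      x ^ᴷ (N * q * q)       ≈⟨ ^-assocʳ x (N * q) q ⟨
      σ (x ^ᴷ (N * q))       ≈⟨ σ.cong (^-assocʳ x N q) ⟨
      σ (σ (x ^ᴷ N))         ∎

  fixed^w≈1 : ∀ {x} → Fixed x → ¬ x ≈ 0# → x ^ᴷ w ≈ 1#
  fixed^w≈1 {x} x-fixed = x^[1+w]≈x⇒x^w≈1 w (≡.subst (λ e → x ^ᴷ e ≈ x) (≡.sym 1+w≡q) x-fixed)

  -- If σ fixed every unit, each would be a root of `X^w - 1`, and K has too many units for that.
  unfixed : ∃ λ y → ¬ Fixed y
  unfixed with Finₚ.any? (λ i → ¬? (σ (unit i) ≟ unit i))
  ... | yes (i , u-unfixed) = unit i , u-unfixed
  ... | no  all-fixed = contradiction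
    (λ i → fixed^w≈1 (stable i) (unit≉0 (inject≤ i 1+w≤v)))
    (roots-of-unity-bound w (λ i → unit (inject≤ i 1+w≤v)) (Finₚ.inject≤-injective 1+w≤v 1+w≤v _ _ ∘ unit-injective))
    where
    stable : ∀ i → Fixed (unit (inject≤ i 1+w≤v))
    stable i with σ (unit (inject≤ i 1+w≤v)) ≟ unit (inject≤ i 1+w≤v)
    ... | yes u-fixed = u-fixed
    ... | no u-unfixed = contradiction (inject≤ i 1+w≤v , u-unfixed) all-fixed

  coprime⇒power-injective : ∀ N .{{_ : NonZero N}} → Coprime w N →
    ∀ {a b} → Fixed a → Fixed b → a ^ᴷ N ≈ b ^ᴷ N → a ≈ b
  coprime⇒power-injective N w⊥N {a} {b} a-fixed b-fixed a^N≈b^N with a ≟ 0# | b ≟ 0#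
  ... | yes a≈0 | _       = trans a≈0 (sym (x^n≈0⇒x≈0 N (trans (sym a^N≈b^N) (trans (^-congˡ N a≈0) (^-zeroˡ N)))))
  ... | no  a≉0 | yes b≈0 = contradiction (x^n≈0⇒x≈0 N (trans a^N≈b^N (trans (^-congˡ N b≈0) (^-zeroˡ N)))) a≉0
  ... | no  a≉0 | no  b≉0 = let e , root = coprime⇒root w N w⊥N in begin
    a                   ≈⟨ root (fixed^w≈1 a-fixed a≉0) ⟨
    a ^ᴷ (N * e)        ≈⟨ ^-assocʳ a N e ⟨
    (a ^ᴷ N) ^ᴷ e       ≈⟨ ^-congˡ e a^N≈b^N ⟩
    (b ^ᴷ N) ^ᴷ e       ≈⟨ ^-assocʳ b N e ⟩
    b ^ᴷ (N * e)        ≈⟨ root (fixed^w≈1 b-fixed b≉0) ⟩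
    b                   ∎

  fixed-^ : ∀ {x} → Fixed x → ∀ n → Fixed (x ^ᴷ n)
  fixed-^ {x} x-fixed n = trans (^-commute q n x) (^-congˡ n x-fixed)

  coprime⇒fixed-root : ∀ N .{{_ : NonZero N}} → Coprime w N → ∀ {s} → Fixed s → ∃ λ t → Fixed t × t ^ᴷ N ≈ s
  coprime⇒fixed-root N w⊥N {s} s-fixed with s ≟ 0#
  ... | yes s≈0 = s , s-fixed , trans (^-congˡ N s≈0) (trans (^-zeroˡ N) (sym s≈0))
  ... | no  s≉0 = let e , root = coprime⇒root w N w⊥N in s ^ᴷ e , fixed-^ s-fixed e , (begin
    (s ^ᴷ e) ^ᴷ N       ≈⟨ ^-assocʳ s e N ⟩
    s ^ᴷ (e * N)        ≡⟨ ≡.cong (s ^ᴷ_) (ℕₚ.*-comm e N) ⟩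
    s ^ᴷ (N * e)        ≈⟨ root (fixed^w≈1 s-fixed s≉0) ⟩
    s                   ∎)

  -- The units of F embed as `w` distinct fixed `w`-th roots of unity, which is the supply of roots
  -- that the counting argument asks for.
  power-injective⇒coprime : ∀ N → (∀ {a b} → Fixed a → Fixed b → a ^ᴷ N ≈ b ^ᴷ N → a ≈ b) → Coprime w N
  power-injective⇒coprime N ^N-injective = injective⇒coprime (ι ∘ FF.unit)
    (FF.unit-injective ∘ ι-injective w orderF′)
    (λ i → fixed^w≈1 (ι-fixed-by-σ (FF.unit i)) (FF.unit≉0 i ∘ ι≈0⇒≈0 w orderF′))
    (λ i M x^M^N≈1 → ^N-injective (fixed-^ (ι-fixed-by-σ (FF.unit i)) M) (1^n≈1 q) (trans x^M^N≈1 (sym (1^n≈1 N))))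

  instance
    Q+1≢0 : NonZero (Q + 1)
    Q+1≢0 = ℕ.>-nonZero (ℕₚ.m≤n+m 1 Q)
    R+S≢0 : NonZero (R + S)
    R+S≢0 = ℕ.>-nonZero (ℕₚ.≤-trans (ℕₚ.m^n>0 2 m) (ℕₚ.m≤m+n R S))

  coprime⇒permutes : Coprime w ((Q + 1) * (R + S)) → Permutes K (map ι (f F q Q R S c))
  coprime⇒permutes w⊥ = injective⇒bijective φ (ev-cong (f F q Q R S c)) λ {x} {y} φx≈φy →
    g-injective
      (λ {a} {b} a-fixed b-fixed eq → coprime⇒power-injective (Q + 1) (coprime-∣ (m∣m*n (R + S)) w⊥) a-fixed b-fixed
        (trans (sym (τx*x≈^ a)) (trans eq (τx*x≈^ b))))
      (λ {a} {b} a-fixed b-fixed eq → coprime⇒power-injective (R + S) (coprime-∣ (∣n⇒∣m*n (Q + 1) ∣-refl) w⊥) a-fixed b-fixed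
        (trans (sym (ν≈^ a)) (trans eq (ν≈^ b))))
      (trans (sym (φ≈g x)) (trans φx≈φy (φ≈g y)))

  permutes⇒coprime : Permutes K (map ι (f F q Q R S c)) → Coprime w ((Q + 1) * (R + S))
  permutes⇒coprime (φ-injective , _) = coprime-* w⊥Q+1 w⊥R+S
    where
    g-inj : ∀ {x y} → g x ≈ g y → x ≈ y
    g-inj {x} {y} gx≈gy = φ-injective (trans (φ≈g x) (trans gx≈gy (sym (φ≈g y))))
    w⊥R+S : Coprime w (R + S)
    w⊥R+S = power-injective⇒coprime (R + S) λ {a} {b} a-fixed b-fixed eq →
      ν-injective g-inj a-fixed b-fixed (trans (ν≈^ a) (trans eq (sym (ν≈^ b))))
    -- Coprimality with `R + S`, just obtained, makes `ν` surjective on fixed elements; the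
    -- correction term in `τa*a-injective` depends on it.
    ν-root : ∀ {s} → Fixed s → ∃ λ t → Fixed t × ν t ≈ s
    ν-root s-fixed = let t , t-fixed , eq = coprime⇒fixed-root (R + S) w⊥R+S s-fixed in t , t-fixed , trans (ν≈^ t) eq
    w⊥Q+1 : Coprime w (Q + 1)
    w⊥Q+1 = power-injective⇒coprime (Q + 1) λ {a} {b} a-fixed b-fixed eq →
      τa*a-injective g-inj ν-root (proj₂ unfixed) a-fixed b-fixed (trans (τx*x≈^ a) (trans eq (sym (τx*x≈^ b))))

theorem1p1 :
  ∀ {a₁ ℓ₁ ℓ₁′ a₂ ℓ₂ ℓ₂′ : Level}
    (p k ℓ m n : ℕ) → Prime p → 0 < k →
    let q = p ^ k
        Q = p ^ ℓ
        R = p ^ m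
        S = p ^ n
    in
    (F : HeytingField a₁ ℓ₁ ℓ₁′) → HasOrder F q →
    (K : HeytingField a₂ ℓ₂ ℓ₂′) → HasOrder K (q ^ 3) →
    (ι : HeytingField.Carrier F → HeytingField.Carrier K) →
    IsRingHomomorphism (fieldRawRing F) (fieldRawRing K) ι →
    (c : HeytingField.Carrier F) →
    ¬ HeytingField._≈_ F c (HeytingField.0# F) →
    Polynomial._≈_ (fieldRawRing F) (f F q Q R S c) (fComposed F q Q R S c)
    × (Permutes K (map ι (f F q Q R S c)) ⇔ gcd (q ∸ 1) ((Q + 1) * (R + S)) ≡ 1)
    × (Permutes K (map ι (f F q Q R S c))
        ⇔ (p ≡ 2 × ord₂ (+ k) ≤∞ min∞ (ord₂ (+ ℓ)) (ord₂ (+ m - + n))))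
theorem1p1 p k ℓ m n p-prime 0<k F orderF K orderK ι ι-hom c c≉0 =
  f≈fComposed F q Q R S c c^q≈c , permutes⇔gcd , permutes⇔ord₂
  where
  q Q R S : ℕ
  q = p ^ k
  Q = p ^ ℓ
  R = p ^ m
  S = p ^ n

  instance
    k≢0 : NonZero k
    k≢0 = ℕ.>-nonZero 0<k

  q≢0 : NonZero q
  q≢0 = ℕₚ.m^n≢0 p k {{prime⇒nonZero p-prime}}

  1+[q∸1]≡q : suc (q ∸ 1) ≡ q
  1+[q∸1]≡q = ℕₚ.m+[n∸m]≡n (ℕ.>-nonZero⁻¹ q {{q≢0}})

  c^q≈c : let open FieldProperties F using (_≈_) renaming (_^_ to _^ᶠ_) in c ^ᶠ q ≈ c
  c^q≈c = ≡.subst (λ e → c ^ᶠ e ≈ c) 1+[q∸1]≡q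
    (FiniteField.x^[1+m]≈x F (q ∸ 1) (≡.subst (HasOrder F) (≡.sym 1+[q∸1]≡q) orderF) c)
    where open FieldProperties F using (_≈_) renaming (_^_ to _^ᶠ_)

  1+[q³∸1]≡q³ : suc (q ^ 3 ∸ 1) ≡ q ^ 3
  1+[q³∸1]≡q³ = ℕₚ.m+[n∸m]≡n (ℕ.>-nonZero⁻¹ (q ^ 3) {{ℕₚ.m^n≢0 q 3 {{q≢0}}}})

  odd-common : p ≢ 2 → 2 ∣ q ∸ 1 × 2 ∣ (Q + 1) * (R + S)
  odd-common p≢2 = odd⇒2∣∸1 (odd^n odd-p k) , ∣n⇒∣m*n (Q + 1) (odd+odd (odd^n odd-p m) (odd^n odd-p n))
    where odd-p = odd-prime p-prime p≢2

  permutes⇔coprime : Permutes K (map ι (f F q Q R S c)) ⇔ Coprime (q ∸ 1) ((Q + 1) * (R + S))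
  permutes⇔coprime with p ℕₚ.≟ 2
  ... | yes ≡.refl = mk⇔ permutes⇒coprime coprime⇒permutes
    where open EvenCharacteristic k ℓ m n F orderF K orderK ι ι-hom c c≉0
  ... | no p≢2 = mk⇔ (λ permutes → contradiction permutes not-permutes) (λ q∸1⊥ → contradiction (q∸1⊥ (odd-common p≢2)) λ ())
    where
    odd-p = odd-prime p-prime p≢2
    not-permutes = OddCharacteristic.¬permutes F K ι ι-hom q Q R S c
      (Characteristic.1+1≉0 K (q ^ 3 ∸ 1) (≡.subst (HasOrder K) (≡.sym 1+[q³∸1]≡q³) orderK)
        (≡.subst Odd (≡.sym 1+[q³∸1]≡q³) (odd^n (odd^n odd-p k) 3)))
      (odd^n odd-p k) (odd+odd (odd^n odd-p m) (odd^n odd-p n))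

  permutes⇔gcd : Permutes K (map ι (f F q Q R S c)) ⇔ gcd (q ∸ 1) ((Q + 1) * (R + S)) ≡ 1
  permutes⇔gcd = mk⇔
    (Coprimality.coprime⇒gcd≡1 ∘ Equivalence.to permutes⇔coprime)
    (λ gcd≡1 → Equivalence.from permutes⇔coprime (Coprimality.gcd≡1⇒coprime gcd≡1))

  permutes⇔ord₂ : Permutes K (map ι (f F q Q R S c)) ⇔
                  (p ≡ 2 × ord₂ (+ k) ≤∞ min∞ (ord₂ (+ ℓ)) (ord₂ (+ m - + n)))
  permutes⇔ord₂ = mk⇔ to from
    where
    coprime⇔ : p ≡ 2 → Coprime (q ∸ 1) ((Q + 1) * (R + S)) ⇔ ord₂ (+ k) ≤∞ min∞ (ord₂ (+ ℓ)) (ord₂ (+ m - + n))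
    coprime⇔ ≡.refl = coprime⇔ord₂ k ℓ m n
    to : Permutes K (map ι (f F q Q R S c)) → p ≡ 2 × ord₂ (+ k) ≤∞ min∞ (ord₂ (+ ℓ)) (ord₂ (+ m - + n))
    to permutes with p ℕₚ.≟ 2
    ... | yes p≡2 = p≡2 , Equivalence.to (coprime⇔ p≡2) (Equivalence.to permutes⇔coprime permutes)
    ... | no p≢2 = contradiction (Equivalence.to permutes⇔coprime permutes (odd-common p≢2)) λ ()
    from : p ≡ 2 × ord₂ (+ k) ≤∞ min∞ (ord₂ (+ ℓ)) (ord₂ (+ m - + n)) → Permutes K (map ι (f F q Q R S c))
    from (p≡2 , s≤min) = Equivalence.from permutes⇔coprime (Equivalence.from (coprime⇔ p≡2) s≤min)
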